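{- For every $r\ge0$, the formal power series $M_r(x)$ is a rational function of $x$ and $\sqrt{1-4x^2}$; that is, $M_r(x)\in\mathbb Q\big(x,\sqrt{1-4x^2}\big)$.
   Context: An occurrence of $132$ in $\pi=\pi_1\cdots\pi_n$ is a triple $i<j<k$ with $\pi_i<\pi_k<\pi_j$. $\operatorname{sign}(\pi)=(-1)^{\#\text{inversions}}$, and the empty permutation has sign $1$. $M_r(x)=\sum_{n\ge0}\sum_{\pi\in\mathfrak S_n \text{ with exactly } r \text{ occurrences of } 132}\operatorname{sign}(\pi)\,x^n$, i.e. the number of even minus the number of odd such permutations, as generating function. $\sqrt{1-4x^2}$ denotes the power series with constant term $1$. -}

module Defs where

open import Data.Bool using (Bool; true; false; not; _∧_; if_then_else_)
open import Data.Nat using (ℕ; zero; suc; _≡ᵇ_; _<ᵇ_; _∸_)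
open import Data.Integer as ℤ using (ℤ; +_; -_)
open import Data.List using (List; []; _∷_; map; concatMap; upTo; foldr)
open import Data.Rational using (ℚ; 0ℚ; 1ℚ; _+_; _*_; _/_)

-- Permutations, represented as words π₁⋯πₙ over {0,…,n-1}.
-- words n k = all lists of length k with entries in {0,…,n-1}.
words : ℕ → ℕ → List (List ℕ)
words n zero    = [] ∷ []
words n (suc k) = concatMap (λ i → map (i ∷_) (words n k)) (upTo n)

elemᵇ : ℕ → List ℕ → Bool
elemᵇ a []      = false
elemᵇ a (b ∷ l) = if a ≡ᵇ b then true else elemᵇ a l

distinct : List ℕ → Bool
distinct []      = true
distinct (a ∷ l) = not (elemᵇ a l) ∧ distinct l

-- A word of length n over {0..n-1} is a permutation in S_n iff it is distinct.
isPerm : List ℕ → Bool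
isPerm = distinct

countBetween : ℕ → ℕ → List ℕ → ℕ
countBetween a b []      = 0
countBetween a b (c ∷ l) =
  (if (a <ᵇ c) ∧ (c <ᵇ b) then 1 else 0) Data.Nat.+ countBetween a b l

pairs132 : ℕ → List ℕ → ℕ
pairs132 a []      = 0
pairs132 a (b ∷ l) = countBetween a b l Data.Nat.+ pairs132 a l

occ132 : List ℕ → ℕ
occ132 []      = 0
occ132 (a ∷ l) = pairs132 a l Data.Nat.+ occ132 l

countLess : ℕ → List ℕ → ℕ
countLess a []      = 0
countLess a (c ∷ l) = (if c <ᵇ a then 1 else 0) Data.Nat.+ countLess a l

inversions : List ℕ → ℕ
inversions []      = 0
inversions (a ∷ l) = countLess a l Data.Nat.+ inversions l

evenᵇ : ℕ → Bool
evenᵇ zero          = true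
evenᵇ (suc zero)    = false
evenᵇ (suc (suc n)) = evenᵇ n

sign : List ℕ → ℤ
sign π = if evenᵇ (inversions π) then + 1 else - (+ 1)

sumℤ : List ℤ → ℤ
sumℤ = foldr ℤ._+_ (+ 0)

Mcoeff : ℕ → ℕ → ℤ
Mcoeff r n = sumℤ (map (λ π → if isPerm π ∧ (occ132 π ≡ᵇ r) then sign π else + 0)
                       (words n n))

Series : Set
Series = ℕ → ℚ

M : ℕ → Series
M r n = Mcoeff r n / 1

zeroS : Series
zeroS _ = 0ℚ

_+S_ : Series → Series → Series
(f +S g) n = f n + g n

sumTo : (ℕ → ℚ) → ℕ → ℚ
sumTo h zero    = h 0
sumTo h (suc n) = sumTo h n + h (suc n)

_*S_ : Series → Series → Series
(f *S g) n = sumTo (λ i → f i * g (n ∸ i)) n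

oneMinus4x² : Series
oneMinus4x² zero             = 1ℚ
oneMinus4x² (suc zero)       = 0ℚ
oneMinus4x² (suc (suc zero)) = - (+ 4) / 1
oneMinus4x² (suc (suc (suc _))) = 0ℚ

polyS : List ℚ → Series
polyS []      n       = 0ℚ
polyS (a ∷ p) zero    = a
polyS (a ∷ p) (suc n) = polyS p n

-- A bivariate polynomial P(x,y) = Σ_j p_j(x) y^j, given as the list [p_0, p_1, …],
-- evaluated at y := s ∈ ℚ[[x]] (Horner scheme).
evalXY : List (List ℚ) → Series → Series
evalXY []       s = zeroS
evalXY (p ∷ ps) s = polyS p +S (s *S evalXY ps s)

-- F ∈ ℚ(x, s): F = N(x,s)/D(x,s) for polynomials N, D ∈ ℚ[x,y] with D(x,s) ≠ 0,
-- the equation read in ℚ[[x]] (i.e. D(x,s)·F = N(x,s)).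
InRatXS : Series → Series → Set
InRatXS s F =
  Σ (List (List ℚ)) λ N → Σ (List (List ℚ)) λ D →
    (¬ (∀ n → evalXY D s n ≡ 0ℚ)) × (∀ n → (evalXY D s *S F) n ≡ evalXY N s n)
  where
  open import Data.Product using (Σ; _×_)
  open import Relation.Nullary using (¬_)
  open import Relation.Binary.PropositionalEquality using (_≡_)

{-# OPTIONS --safe #-}

module Submission where

-- Reading a permutation from left to right, record the set of used values as a word over
-- {used, unused}.  Using a value creates one inversion for each unused value below it, and
-- as many occurrences of 132 (with that value as the 3) as there are pairs of a used value
-- below an unused one, both below it.  Splitting at the moment when the largest value is used,
-- only few words can occur: if at most r occurrences are allowed then, apart from unused
-- values at the bottom and used values at the top, the word is one of finitely many cores.
-- The generating functions of the ways to get from a core to a core therefore satisfy finitely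
-- many (twisted) convolution equations, which are linear except for r = 0, where
-- y = M₀ - 1 solves y = x (1 + y²).

open import Defs
open import Algebra.Bundles using (CommutativeRing; RawRing)
open import Algebra.Structures using (IsCommutativeRing)
import Algebra.Solver.Ring
open import Algebra.Solver.Ring.AlmostCommutativeRing using (fromCommutativeRing; _-Raw-AlmostCommutative⟶_)
open import Data.Bool using (Bool; true; false; not; _∧_; if_then_else_)
import Data.Bool.Properties as Boolₚ
open import Data.Empty using (⊥)
open import Data.Integer as ℤ using (ℤ)
import Data.Integer.Properties as ℤₚ
open import Data.List using (List; []; _∷_; map; _++_; length; replicate; upTo; concatMap)
import Data.List.Properties as Listₚ
open import Data.List.Relation.Unary.All using (All; []; _∷_)
open import Data.Maybe using (Maybe; just; nothing)
open import Data.Nat as ℕ using (ℕ; zero; suc; _∸_; _≤_; _<_; z≤n; s≤s; _≡ᵇ_; _<ᵇ_)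
open import Data.Nat.Induction using (<-rec)
import Data.Nat.Properties as ℕₚ
import Data.Nat.Solver
open import Data.Product using (Σ; _×_; _,_; proj₂)
open import Data.Rational using (ℚ; 0ℚ; 1ℚ; ½; _+_; _*_; -_; _/_; toℚᵘ)
import Data.Rational.Properties as ℚₚ
import Data.Rational.Solver
open import Data.Rational.Unnormalised as ℚᵘ using (mkℚᵘ; *≡*)
import Data.Rational.Unnormalised.Properties as ℚᵘₚ
open import Data.Sum using (inj₁; inj₂)
open import Data.Unit using (⊤; tt)
open import Function using (_∘_)
open import Level using (0ℓ)
open import Relation.Binary.PropositionalEquality
open import Relation.Nullary using (contradiction; yes; no)

-- The core-to-core series are forced by the splitting: the word at the split ends one part and
-- starts the other, so the series `M r` alone do not form a closed system. Hence both parts are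
-- again series between cores. A nonempty core has positive area, so it costs an occurrence and
-- leaves fewer than r on both sides. Unknown series survive only in the terms of the empty core,
-- which is why the equations are linear for r > 0. The obstacle is the sign. Each of i untouched
-- values at the bottom adds an inversion to every step of the first part, so a product of
-- coefficients with indices k and i carries (-1)^(ik), up to factors depending on i and the cores.
-- The equations therefore mix F(x) and F(-x); they can be solved because the root of 1 - 4x² is
-- even, so that x ↦ -x preserves the field. Divisions are only by series with constant term 1.

module ℚ-Solver = Data.Rational.Solver.+-*-Solver

-- Finite sums of rationals

sumTo-cong-≤ : ∀ {f g} n → (∀ i → i ≤ n → f i ≡ g i) → sumTo f n ≡ sumTo g n
sumTo-cong-≤ zero    e = e 0 z≤n
sumTo-cong-≤ (suc n) e =
  cong₂ _+_ (sumTo-cong-≤ n (λ i i≤n → e i (ℕₚ.m≤n⇒m≤1+n i≤n))) (e (suc n) ℕₚ.≤-refl)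

sumTo-cong : ∀ {f g} n → (∀ i → f i ≡ g i) → sumTo f n ≡ sumTo g n
sumTo-cong n e = sumTo-cong-≤ n (λ i _ → e i)

sumTo-zero : ∀ {f} n → (∀ i → i ≤ n → f i ≡ 0ℚ) → sumTo f n ≡ 0ℚ
sumTo-zero zero    e = e 0 z≤n
sumTo-zero (suc n) e =
  cong₂ _+_ (sumTo-zero n (λ i i≤n → e i (ℕₚ.m≤n⇒m≤1+n i≤n))) (e (suc n) ℕₚ.≤-refl)

+-interchange : ∀ a b c d → (a + b) + (c + d) ≡ (a + c) + (b + d)
+-interchange = solve 4 (λ a b c d → (a :+ b) :+ (c :+ d) := (a :+ c) :+ (b :+ d)) refl
  where open ℚ-Solver

sumTo-+ : ∀ f g n → sumTo (λ i → f i + g i) n ≡ sumTo f n + sumTo g n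
sumTo-+ f g zero    = refl
sumTo-+ f g (suc n) =
  trans (cong (_+ (f (suc n) + g (suc n))) (sumTo-+ f g n))
        (+-interchange (sumTo f n) (sumTo g n) (f (suc n)) (g (suc n)))

sumTo-*ˡ : ∀ c f n → sumTo (λ i → c * f i) n ≡ c * sumTo f n
sumTo-*ˡ c f zero    = refl
sumTo-*ˡ c f (suc n) =
  trans (cong (_+ c * f (suc n)) (sumTo-*ˡ c f n))
        (sym (ℚₚ.*-distribˡ-+ c (sumTo f n) (f (suc n))))

sumTo-head : ∀ f n → sumTo f (suc n) ≡ f 0 + sumTo (λ i → f (suc i)) n
sumTo-head f zero    = refl
sumTo-head f (suc n) =
  trans (cong (_+ f (suc (suc n))) (sumTo-head f n))
        (ℚₚ.+-assoc (f 0) (sumTo (λ i → f (suc i)) n) (f (suc (suc n))))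

sumTo-reverse : ∀ f n → sumTo f n ≡ sumTo (λ i → f (n ∸ i)) n
sumTo-reverse f zero    = refl
sumTo-reverse f (suc n) = begin
  sumTo f n + f (suc n)                       ≡⟨ ℚₚ.+-comm (sumTo f n) (f (suc n)) ⟩
  f (suc n) + sumTo f n                       ≡⟨ cong (f (suc n) +_) (sumTo-reverse f n) ⟩
  f (suc n) + sumTo (λ i → f (n ∸ i)) n       ≡⟨ sumTo-head (λ i → f (suc n ∸ i)) n ⟨
  sumTo (λ i → f (suc n ∸ i)) (suc n)         ∎
  where open ≡-Reasoning

sumTo-swap : ∀ (h : ℕ → ℕ → ℚ) m n →
  sumTo (λ i → sumTo (h i) n) m ≡ sumTo (λ j → sumTo (λ i → h i j) m) n
sumTo-swap h zero    n = refl
sumTo-swap h (suc m) n =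
  trans (cong (_+ sumTo (h (suc m)) n) (sumTo-swap h m n))
        (sym (sumTo-+ (λ j → sumTo (λ i → h i j) m) (h (suc m)) n))

-- Formal power series form a commutative ring

infix 4 _≈_
_≈_ : Series → Series → Set
f ≈ g = ∀ n → f n ≡ g n

scale : ℚ → Series → Series
scale c f n = c * f n

constS : ℚ → Series
constS c zero    = c
constS c (suc n) = 0ℚ

1S : Series
1S = constS 1ℚ

tailS : Series → Series
tailS f n = f (suc n)

*S-cong : ∀ {f f' g g'} → f ≈ f' → g ≈ g' → f *S g ≈ f' *S g'
*S-cong e e' n = sumTo-cong n (λ i → cong₂ _*_ (e i) (e' (n ∸ i)))

*S-suc : ∀ f g n → (f *S g) (suc n) ≡ f 0 * g (suc n) + (tailS f *S g) n
*S-suc f g n = sumTo-head (λ i → f i * g (suc n ∸ i)) n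

*S-comm : ∀ f g → f *S g ≈ g *S f
*S-comm f g n = trans (sumTo-reverse (λ i → f i * g (n ∸ i)) n) (sumTo-cong-≤ n λ i i≤n →
  trans (cong (λ k → f (n ∸ i) * g k) (ℕₚ.m∸[m∸n]≡n i≤n)) (ℚₚ.*-comm (f (n ∸ i)) (g i)))

*S-distribʳ : ∀ h f g → (f +S g) *S h ≈ (f *S h) +S (g *S h)
*S-distribʳ h f g n =
  trans (sumTo-cong n (λ i → ℚₚ.*-distribʳ-+ (h (n ∸ i)) (f i) (g i)))
        (sumTo-+ (λ i → f i * h (n ∸ i)) (λ i → g i * h (n ∸ i)) n)

*S-distribˡ : ∀ h f g → h *S (f +S g) ≈ (h *S f) +S (h *S g)
*S-distribˡ h f g n =
  trans (sumTo-cong n (λ i → ℚₚ.*-distribˡ-+ (h i) (f (n ∸ i)) (g (n ∸ i))))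
        (sumTo-+ (λ i → h i * f (n ∸ i)) (λ i → h i * g (n ∸ i)) n)

scale-*S : ∀ c f g → scale c f *S g ≈ scale c (f *S g)
scale-*S c f g n =
  trans (sumTo-cong n (λ i → ℚₚ.*-assoc c (f i) (g (n ∸ i))))
        (sumTo-*ˡ c (λ i → f i * g (n ∸ i)) n)

-- Writing f = f₀ + x · `tailS f` reduces coefficient n + 1 to coefficient n with `tailS f` in place
-- of f, which avoids reindexing a triple sum.
*S-assoc : ∀ f g h → (f *S g) *S h ≈ f *S (g *S h)
*S-assoc f g h zero    = ℚₚ.*-assoc (f 0) (g 0) (h 0)
*S-assoc f g h (suc n) = begin
  ((f *S g) *S h) (suc n)
    ≡⟨ *S-suc (f *S g) h n ⟩
  f 0 * g 0 * h (suc n) + (tailS (f *S g) *S h) n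
    ≡⟨ cong (f 0 * g 0 * h (suc n) +_) (*S-cong {g = h} (*S-suc f g) (λ _ → refl) n) ⟩
  f 0 * g 0 * h (suc n) + ((scale (f 0) (tailS g) +S (tailS f *S g)) *S h) n
    ≡⟨ cong (f 0 * g 0 * h (suc n) +_) (*S-distribʳ h (scale (f 0) (tailS g)) (tailS f *S g) n) ⟩
  f 0 * g 0 * h (suc n) + ((scale (f 0) (tailS g) *S h) n + ((tailS f *S g) *S h) n)
    ≡⟨ cong₂ (λ a b → f 0 * g 0 * h (suc n) + (a + b))
             (scale-*S (f 0) (tailS g) h n) (*S-assoc (tailS f) g h n) ⟩
  f 0 * g 0 * h (suc n) + (f 0 * (tailS g *S h) n + (tailS f *S (g *S h)) n)
    ≡⟨ solve 5 (λ a b c d e → a :* b :* c :+ (a :* d :+ e) := a :* (b :* c :+ d) :+ e) refl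
         (f 0) (g 0) (h (suc n)) ((tailS g *S h) n) ((tailS f *S (g *S h)) n) ⟩
  f 0 * (g 0 * h (suc n) + (tailS g *S h) n) + (tailS f *S (g *S h)) n
    ≡⟨ cong (λ a → f 0 * a + (tailS f *S (g *S h)) n) (*S-suc g h n) ⟨
  f 0 * (g *S h) (suc n) + (tailS f *S (g *S h)) n
    ≡⟨ *S-suc f (g *S h) n ⟨
  (f *S (g *S h)) (suc n) ∎
  where open ≡-Reasoning
        open ℚ-Solver

zeroS-*S : ∀ g → zeroS *S g ≈ zeroS
zeroS-*S g n = sumTo-zero n (λ i _ → ℚₚ.*-zeroˡ (g (n ∸ i)))

constS-*S : ∀ c g → constS c *S g ≈ scale c g
constS-*S c g zero    = refl
constS-*S c g (suc n) = begin
  (constS c *S g) (suc n)            ≡⟨ *S-suc (constS c) g n ⟩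
  c * g (suc n) + (zeroS *S g) n     ≡⟨ cong (c * g (suc n) +_) (zeroS-*S g n) ⟩
  c * g (suc n) + 0ℚ                 ≡⟨ ℚₚ.+-identityʳ (c * g (suc n)) ⟩
  c * g (suc n)                      ∎
  where open ≡-Reasoning

*S-identityˡ : ∀ g → 1S *S g ≈ g
*S-identityˡ g n = trans (constS-*S 1ℚ g n) (ℚₚ.*-identityˡ (g n))

infixl 6 _⊕_
infixl 7 _⊗_
infix  8 ⊖_

-- Series are functions, so the operations are kept opaque: otherwise η-expansion unfolds
-- them to coefficients during unification.
opaque
  _⊕_ : Series → Series → Series
  _⊕_ = _+S_

  _⊗_ : Series → Series → Series
  _⊗_ = _*S_

  ⊖_ : Series → Series
  (⊖ f) n = - f n

  ⊕-at : ∀ f g n → (f ⊕ g) n ≡ f n + g n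
  ⊕-at f g n = refl

  ⊖-at : ∀ f n → (⊖ f) n ≡ - f n
  ⊖-at f n = refl

  ⊗-at : ∀ f g n → (f ⊗ g) n ≡ (f *S g) n
  ⊗-at f g n = refl

  ⊕-⊗-isCommutativeRing : IsCommutativeRing _≈_ _⊕_ _⊗_ ⊖_ zeroS 1S
  ⊕-⊗-isCommutativeRing = record
    { isRing = record
      { +-isAbelianGroup = record
        { isGroup = record
          { isMonoid = record
            { isSemigroup = record
              { isMagma = record
                { isEquivalence = record
                  { refl  = λ _ → refl
                  ; sym   = λ e n → sym (e n)
                  ; trans = λ e e' n → trans (e n) (e' n) }
                ; ∙-cong = λ e e' n → cong₂ _+_ (e n) (e' n) }
              ; assoc = λ f g h n → ℚₚ.+-assoc (f n) (g n) (h n) }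
            ; identity = (λ f n → ℚₚ.+-identityˡ (f n)) , (λ f n → ℚₚ.+-identityʳ (f n)) }
          ; inverse = (λ f n → ℚₚ.+-inverseˡ (f n)) , (λ f n → ℚₚ.+-inverseʳ (f n))
          ; ⁻¹-cong = λ e n → cong -_ (e n) }
        ; comm = λ f g n → ℚₚ.+-comm (f n) (g n) }
      ; *-cong = λ {f} {f'} {g} {g'} → *S-cong {f} {f'} {g} {g'}
      ; *-assoc = *S-assoc
      ; *-identity = *S-identityˡ , (λ g n → trans (*S-comm g 1S n) (*S-identityˡ g n))
      ; distrib = *S-distribˡ , *S-distribʳ }
    ; *-comm = *S-comm }

  ⊗-suc : ∀ f g n → (f ⊗ g) (suc n) ≡ f 0 * g (suc n) + (tailS f ⊗ g) n
  ⊗-suc = *S-suc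

  constS-⊗ : ∀ c g → constS c ⊗ g ≈ scale c g
  constS-⊗ = constS-*S

  constS-+ : ∀ a b → constS (a + b) ≈ constS a ⊕ constS b
  constS-+ a b zero    = refl
  constS-+ a b (suc n) = refl

  constS-* : ∀ a b → constS (a * b) ≈ constS a ⊗ constS b
  constS-* a b zero    = refl
  constS-* a b (suc n) = sym (trans (constS-*S a (constS b) (suc n)) (ℚₚ.*-zeroʳ a))

  constS-neg : ∀ a → constS (- a) ≈ ⊖ constS a
  constS-neg a zero    = refl
  constS-neg a (suc n) = refl

constS-0 : constS 0ℚ ≈ zeroS
constS-0 zero    = refl
constS-0 (suc n) = refl

seriesRing : CommutativeRing 0ℓ 0ℓ
seriesRing = record { isCommutativeRing = ⊕-⊗-isCommutativeRing }

module S = CommutativeRing seriesRing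

ℚ-rawRing : RawRing 0ℓ 0ℓ
ℚ-rawRing = CommutativeRing.rawRing ℚₚ.+-*-commutativeRing

-- Makes rational scalars such as ½ and 4 available as coefficients of the ring solver for series.
constS-hom : ℚ-rawRing -Raw-AlmostCommutative⟶ fromCommutativeRing seriesRing
constS-hom = record
  { ⟦_⟧    = constS
  ; +-homo = constS-+
  ; *-homo = constS-*
  ; -‿homo = constS-neg
  ; 0-homo = constS-0
  ; 1-homo = λ _ → refl }

constS-≟ : ∀ a b → Maybe (constS a ≈ constS b)
constS-≟ a b with a ℚₚ.≟ b
... | yes e = just (λ n → cong (λ c → constS c n) e)
... | no  _ = nothing

module S-Solver = Algebra.Solver.Ring ℚ-rawRing (fromCommutativeRing seriesRing) constS-hom constS-≟

module ≈-Reasoning where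
  open import Relation.Binary.Reasoning.Setoid S.setoid public

-- Signs and the substitution x ↦ -x

ε : ℕ → ℚ
ε zero    = 1ℚ
ε (suc n) = - ε n

ε-+ : ∀ m n → ε (m ℕ.+ n) ≡ ε m * ε n
ε-+ zero    n = sym (ℚₚ.*-identityˡ (ε n))
ε-+ (suc m) n = trans (cong -_ (ε-+ m n)) (ℚₚ.neg-distribˡ-* (ε m) (ε n))

ε-square : ∀ n → ε n * ε n ≡ 1ℚ
ε-square zero    = refl
ε-square (suc n) = trans (solve 1 (λ a → (:- a) :* (:- a) := a :* a) refl (ε n)) (ε-square n)
  where open ℚ-Solver

tw : Series → Series
tw f n = ε n * f n

tw-cong : ∀ {f g} → f ≈ g → tw f ≈ tw g
tw-cong e n = cong (ε n *_) (e n)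

opaque
  unfolding _⊕_

  tw-+ : ∀ f g → tw (f ⊕ g) ≈ tw f ⊕ tw g
  tw-+ f g n = ℚₚ.*-distribˡ-+ (ε n) (f n) (g n)

  tw-* : ∀ f g → tw (f ⊗ g) ≈ tw f ⊗ tw g
  tw-* f g n = trans (sym (sumTo-*ˡ (ε n) (λ i → f i * g (n ∸ i)) n)) (sumTo-cong-≤ n λ i i≤n → begin
      ε n * (f i * g (n ∸ i))
        ≡⟨ cong (λ k → ε k * (f i * g (n ∸ i))) (ℕₚ.m+[n∸m]≡n i≤n) ⟨
      ε (i ℕ.+ (n ∸ i)) * (f i * g (n ∸ i))
        ≡⟨ cong (_* (f i * g (n ∸ i))) (ε-+ i (n ∸ i)) ⟩
      ε i * ε (n ∸ i) * (f i * g (n ∸ i))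
        ≡⟨ solve 4 (λ a b c d → a :* b :* (c :* d) := a :* c :* (b :* d)) refl
             (ε i) (ε (n ∸ i)) (f i) (g (n ∸ i)) ⟩
      ε i * f i * (ε (n ∸ i) * g (n ∸ i)) ∎)
    where open ≡-Reasoning
          open ℚ-Solver

tw-const : ∀ c → tw (constS c) ≈ constS c
tw-const c zero    = ℚₚ.*-identityˡ c
tw-const c (suc n) = ℚₚ.*-zeroʳ (- ε n)

tw-involutive : ∀ f → tw (tw f) ≈ f
tw-involutive f n = begin
  ε n * (ε n * f n)  ≡⟨ ℚₚ.*-assoc (ε n) (ε n) (f n) ⟨
  ε n * ε n * f n    ≡⟨ cong (_* f n) (ε-square n) ⟩
  1ℚ * f n           ≡⟨ ℚₚ.*-identityˡ (f n) ⟩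
  f n                ∎
  where open ≡-Reasoning

⊗-zero : ∀ f g → (f ⊗ g) 0 ≡ f 0 * g 0
⊗-zero f g = ⊗-at f g 0

-- Cancellation and uniqueness of square roots

X : Series
X = polyS (0ℚ ∷ 1ℚ ∷ [])

polyS-const : ∀ c → polyS (c ∷ []) ≈ constS c
polyS-const c zero    = refl
polyS-const c (suc n) = refl

X-⊗-suc : ∀ f n → (X ⊗ f) (suc n) ≡ f n
X-⊗-suc f n = begin
  (X ⊗ f) (suc n)                                ≡⟨ ⊗-suc X f n ⟩
  0ℚ * f (suc n) + (polyS (1ℚ ∷ []) ⊗ f) n       ≡⟨ cong (_+ (polyS (1ℚ ∷ []) ⊗ f) n) (ℚₚ.*-zeroˡ (f (suc n))) ⟩
  0ℚ + (polyS (1ℚ ∷ []) ⊗ f) n                   ≡⟨ ℚₚ.+-identityˡ _ ⟩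
  (polyS (1ℚ ∷ []) ⊗ f) n                        ≡⟨ S.*-congʳ {f} (polyS-const 1ℚ) n ⟩
  (1S ⊗ f) n                                     ≡⟨ S.*-identityˡ f n ⟩
  f n                                             ∎
  where open ≡-Reasoning

X-⊗-zero : ∀ f → (X ⊗ f) 0 ≡ 0ℚ
X-⊗-zero f = trans (⊗-zero X f) (ℚₚ.*-zeroˡ (f 0))

X-cancel : ∀ f g → X ⊗ f ≈ X ⊗ g → f ≈ g
X-cancel f g e n = trans (sym (X-⊗-suc f n)) (trans (e (suc n)) (X-⊗-suc g n))

opaque
  unfolding _⊕_

  tw-X : tw X ≈ ⊖ X
  tw-X zero          = refl
  tw-X (suc zero)    = refl
  tw-X (suc (suc n)) = ℚₚ.*-zeroʳ (ε (suc (suc n)))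

  -- If all coefficients of f below n vanish, then coefficient n of the product is f n · u 0 = f n;
  -- so f has no first nonzero coefficient.
  unit-cancel : ∀ u f → u 0 ≡ 1ℚ → u ⊗ f ≈ zeroS → f ≈ zeroS
  unit-cancel u f u0 uf n = vanish n n ℕₚ.≤-refl
    where
    open ≡-Reasoning
    top : ∀ n → (∀ i → i < n → f i ≡ 0ℚ) → f n ≡ (f ⊗ u) n
    top zero    _ = trans (sym (ℚₚ.*-identityʳ (f 0))) (cong (f 0 *_) (sym u0))
    top (suc n) z = begin
      f (suc n)                                          ≡⟨ ℚₚ.*-identityʳ (f (suc n)) ⟨
      f (suc n) * 1ℚ                                     ≡⟨ cong (f (suc n) *_) u0 ⟨
      f (suc n) * u 0                                    ≡⟨ cong (λ k → f (suc n) * u k) (ℕₚ.n∸n≡0 n) ⟨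
      f (suc n) * u (n ∸ n)                              ≡⟨ ℚₚ.+-identityˡ _ ⟨
      0ℚ + f (suc n) * u (n ∸ n)                         ≡⟨ cong (_+ f (suc n) * u (n ∸ n)) (sumTo-zero n λ i i≤n →
                                                              trans (cong (_* u (suc n ∸ i)) (z i (s≤s i≤n))) (ℚₚ.*-zeroˡ (u (suc n ∸ i)))) ⟨
      (f ⊗ u) (suc n) ∎

    vanish : ∀ n i → i ≤ n → f i ≡ 0ℚ
    step : ∀ n → (∀ i → i < n → f i ≡ 0ℚ) → f n ≡ 0ℚ
    step n z = trans (top n z) (trans (S.*-comm f u n) (uf n))
    vanish zero    zero    _   = step 0 (λ _ ())
    vanish (suc n) i i≤1+n with ℕₚ.m≤n⇒m<n∨m≡n i≤1+n
    ... | inj₁ (s≤s i≤n) = vanish n i i≤n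
    ... | inj₂ refl      = step (suc n) (λ { j (s≤s j≤n) → vanish n j j≤n })

-- Factor f² - g² = (f + g)(f - g). Half of the first factor has constant term 1, hence can be
-- cancelled.
sqrt-unique : ∀ f g → f 0 ≡ 1ℚ → g 0 ≡ 1ℚ → f ⊗ f ≈ g ⊗ g → f ≈ g
sqrt-unique f g f0 g0 f²≈g² = begin
  f                 ≈⟨ solve 2 (λ a b → a := (a :- b) :+ b) (λ _ → refl) f g ⟩
  (f ⊕ ⊖ g) ⊕ g     ≈⟨ S.+-congʳ {g} (unit-cancel u (f ⊕ ⊖ g) u0 prod) ⟩
  zeroS ⊕ g         ≈⟨ S.+-identityˡ g ⟩
  g                 ∎
  where
  open ≈-Reasoning
  open S-Solver
  u : Series
  u = constS ½ ⊗ (f ⊕ g)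
  u0 : u 0 ≡ 1ℚ
  u0 = trans (⊗-zero (constS ½) (f ⊕ g)) (cong (½ *_) (trans (⊕-at f g 0) (cong₂ _+_ f0 g0)))
  prod : u ⊗ (f ⊕ ⊖ g) ≈ zeroS
  prod = begin
    u ⊗ (f ⊕ ⊖ g)                           ≈⟨ solve 2 (λ f g → con ½ :* (f :+ g) :* (f :- g) := con ½ :* (f :* f :- g :* g)) (λ _ → refl) f g ⟩
    constS ½ ⊗ (f ⊗ f ⊕ ⊖ (g ⊗ g))          ≈⟨ S.*-congˡ (S.+-congʳ f²≈g²) ⟩
    constS ½ ⊗ (g ⊗ g ⊕ ⊖ (g ⊗ g))          ≈⟨ S.*-congˡ (S.-‿inverseʳ (g ⊗ g)) ⟩
    constS ½ ⊗ zeroS                        ≈⟨ S.zeroʳ (constS ½) ⟩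
    zeroS                                   ∎

-- Series rational in x and s

addP : List ℚ → List ℚ → List ℚ
addP []      q       = q
addP (a ∷ p) []      = a ∷ p
addP (a ∷ p) (b ∷ q) = (a + b) ∷ addP p q

polyS-addP : ∀ p q → polyS (addP p q) ≈ polyS p ⊕ polyS q
polyS-addP p q n = trans (add p q n) (sym (⊕-at (polyS p) (polyS q) n))
  where
  add : ∀ p q n → polyS (addP p q) n ≡ polyS p n + polyS q n
  add []      q       n       = sym (ℚₚ.+-identityˡ (polyS q n))
  add (a ∷ p) []      n       = sym (ℚₚ.+-identityʳ (polyS (a ∷ p) n))
  add (a ∷ p) (b ∷ q) zero    = refl
  add (a ∷ p) (b ∷ q) (suc n) = add p q n

polyS-map : ∀ {φ : ℚ → ℚ} → φ 0ℚ ≡ 0ℚ → ∀ p n → polyS (map φ p) n ≡ φ (polyS p n)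
polyS-map φ0 []      n       = sym φ0
polyS-map φ0 (a ∷ p) zero    = refl
polyS-map φ0 (a ∷ p) (suc n) = polyS-map φ0 p n

polyS-∷ : ∀ a p → polyS (a ∷ p) ≈ constS a ⊕ (X ⊗ polyS p)
polyS-∷ a p zero    = sym (trans (⊕-at (constS a) (X ⊗ polyS p) 0) (trans (cong (a +_) (X-⊗-zero (polyS p))) (ℚₚ.+-identityʳ a)))
polyS-∷ a p (suc n) = sym (trans (⊕-at (constS a) (X ⊗ polyS p) (suc n))
  (trans (ℚₚ.+-identityˡ _) (X-⊗-suc (polyS p) n)))

mulP : List ℚ → List ℚ → List ℚ
mulP []      q = []
mulP (a ∷ p) q = addP (map (a *_) q) (0ℚ ∷ mulP p q)

polyS-mulP : ∀ p q → polyS (mulP p q) ≈ polyS p ⊗ polyS q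
polyS-mulP []      q = S.sym (S.zeroˡ (polyS q))
polyS-mulP (a ∷ p) q = begin
  polyS (mulP (a ∷ p) q)
    ≈⟨ polyS-addP (map (a *_) q) (0ℚ ∷ mulP p q) ⟩
  polyS (map (a *_) q) ⊕ polyS (0ℚ ∷ mulP p q)
    ≈⟨ S.+-cong (S.trans (polyS-map (ℚₚ.*-zeroʳ a) q) (S.sym (constS-⊗ a (polyS q))))
                (S.trans (polyS-∷ 0ℚ (mulP p q)) (S.+-congˡ (S.*-congˡ (polyS-mulP p q)))) ⟩
  (constS a ⊗ polyS q) ⊕ (constS 0ℚ ⊕ (X ⊗ (polyS p ⊗ polyS q)))
    ≈⟨ solve 4 (λ a x p q → a :* q :+ (con 0ℚ :+ x :* (p :* q)) := (a :+ x :* p) :* q) (λ _ → refl)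
         (constS a) X (polyS p) (polyS q) ⟩
  (constS a ⊕ (X ⊗ polyS p)) ⊗ polyS q
    ≈⟨ S.*-congʳ {polyS q} (polyS-∷ a p) ⟨
  polyS (a ∷ p) ⊗ polyS q ∎
  where open ≈-Reasoning
        open S-Solver

twP : List ℚ → List ℚ
twP []      = []
twP (a ∷ p) = a ∷ map -_ (twP p)

polyS-twP : ∀ p → polyS (twP p) ≈ tw (polyS p)
polyS-twP []      n       = sym (ℚₚ.*-zeroʳ (ε n))
polyS-twP (a ∷ p) zero    = sym (ℚₚ.*-identityˡ a)
polyS-twP (a ∷ p) (suc n) = trans (polyS-map refl (twP p) n)
  (trans (cong -_ (polyS-twP p n)) (ℚₚ.neg-distribˡ-* (ε n) (polyS p n)))

module Poly (s : Series) where

  eval-∷ : ∀ p N → evalXY (p ∷ N) s ≈ polyS p ⊕ (s ⊗ evalXY N s)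
  eval-∷ p N n = sym (trans (⊕-at (polyS p) (s ⊗ evalXY N s) n) (cong (polyS p n +_) (⊗-at s (evalXY N s) n)))

  IsPoly : Series → Set
  IsPoly f = Σ (List (List ℚ)) λ N → evalXY N s ≈ f

  poly-resp : ∀ {f g} → f ≈ g → IsPoly f → IsPoly g
  poly-resp e (N , h) = N , S.trans h e

  addXY : List (List ℚ) → List (List ℚ) → List (List ℚ)
  addXY []      M       = M
  addXY (p ∷ N) []      = p ∷ N
  addXY (p ∷ N) (q ∷ M) = addP p q ∷ addXY N M

  eval-add : ∀ N M → evalXY (addXY N M) s ≈ evalXY N s ⊕ evalXY M s
  eval-add []      M       = S.sym (S.+-identityˡ _)
  eval-add (p ∷ N) []      = S.sym (S.+-identityʳ _)
  eval-add (p ∷ N) (q ∷ M) = begin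
    evalXY (addXY (p ∷ N) (q ∷ M)) s
      ≈⟨ eval-∷ (addP p q) (addXY N M) ⟩
    polyS (addP p q) ⊕ s ⊗ evalXY (addXY N M) s
      ≈⟨ S.+-cong (polyS-addP p q) (S.*-congˡ (eval-add N M)) ⟩
    (polyS p ⊕ polyS q) ⊕ s ⊗ (evalXY N s ⊕ evalXY M s)
      ≈⟨ solve 5 (λ p q s n m → (p :+ q) :+ s :* (n :+ m) := (p :+ s :* n) :+ (q :+ s :* m)) (λ _ → refl)
           (polyS p) (polyS q) s (evalXY N s) (evalXY M s) ⟩
    (polyS p ⊕ s ⊗ evalXY N s) ⊕ (polyS q ⊕ s ⊗ evalXY M s)
      ≈⟨ S.+-cong (eval-∷ p N) (eval-∷ q M) ⟨
    evalXY (p ∷ N) s ⊕ evalXY (q ∷ M) s ∎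
    where open ≈-Reasoning
          open S-Solver

  eval-mulP : ∀ p N → evalXY (map (mulP p) N) s ≈ polyS p ⊗ evalXY N s
  eval-mulP p []      = S.sym (S.zeroʳ (polyS p))
  eval-mulP p (q ∷ N) = begin
    evalXY (map (mulP p) (q ∷ N)) s
      ≈⟨ eval-∷ (mulP p q) (map (mulP p) N) ⟩
    polyS (mulP p q) ⊕ s ⊗ evalXY (map (mulP p) N) s
      ≈⟨ S.+-cong (polyS-mulP p q) (S.*-congˡ (eval-mulP p N)) ⟩
    polyS p ⊗ polyS q ⊕ s ⊗ (polyS p ⊗ evalXY N s)
      ≈⟨ solve 4 (λ p q s n → p :* q :+ s :* (p :* n) := p :* (q :+ s :* n)) (λ _ → refl)
           (polyS p) (polyS q) s (evalXY N s) ⟩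
    polyS p ⊗ (polyS q ⊕ s ⊗ evalXY N s)
      ≈⟨ S.*-congˡ (eval-∷ q N) ⟨
    polyS p ⊗ evalXY (q ∷ N) s ∎
    where open ≈-Reasoning
          open S-Solver

  mulXY : List (List ℚ) → List (List ℚ) → List (List ℚ)
  mulXY []      M = []
  mulXY (p ∷ N) M = addXY (map (mulP p) M) ([] ∷ mulXY N M)

  eval-mul : ∀ N M → evalXY (mulXY N M) s ≈ evalXY N s ⊗ evalXY M s
  eval-mul []      M = S.sym (S.zeroˡ (evalXY M s))
  eval-mul (p ∷ N) M = begin
    evalXY (mulXY (p ∷ N) M) s
      ≈⟨ eval-add (map (mulP p) M) ([] ∷ mulXY N M) ⟩
    evalXY (map (mulP p) M) s ⊕ evalXY ([] ∷ mulXY N M) s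
      ≈⟨ S.+-cong (eval-mulP p M) (eval-∷ [] (mulXY N M)) ⟩
    polyS p ⊗ evalXY M s ⊕ (zeroS ⊕ s ⊗ evalXY (mulXY N M) s)
      ≈⟨ S.+-congˡ (S.trans (S.+-identityˡ _) (S.*-congˡ (eval-mul N M))) ⟩
    polyS p ⊗ evalXY M s ⊕ s ⊗ (evalXY N s ⊗ evalXY M s)
      ≈⟨ solve 4 (λ p s n m → p :* m :+ s :* (n :* m) := (p :+ s :* n) :* m) (λ _ → refl)
           (polyS p) s (evalXY N s) (evalXY M s) ⟩
    (polyS p ⊕ s ⊗ evalXY N s) ⊗ evalXY M s
      ≈⟨ S.*-congʳ (eval-∷ p N) ⟨
    evalXY (p ∷ N) s ⊗ evalXY M s ∎
    where open ≈-Reasoning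
          open S-Solver

  poly-+ : ∀ {f g} → IsPoly f → IsPoly g → IsPoly (f ⊕ g)
  poly-+ (N , h) (M , k) = addXY N M , S.trans (eval-add N M) (S.+-cong h k)

  poly-* : ∀ {f g} → IsPoly f → IsPoly g → IsPoly (f ⊗ g)
  poly-* (N , h) (M , k) = mulXY N M , S.trans (eval-mul N M) (S.*-cong h k)

  poly-polyS : ∀ p → IsPoly (polyS p)
  poly-polyS p = (p ∷ []) , S.trans (eval-∷ p []) (S.trans (S.+-congˡ (S.zeroʳ s)) (S.+-identityʳ (polyS p)))

  poly-const : ∀ c → IsPoly (constS c)
  poly-const c = poly-resp (polyS-const c) (poly-polyS (c ∷ []))

  poly-s : IsPoly s
  poly-s = ([] ∷ (1ℚ ∷ []) ∷ []) , (begin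
    evalXY ([] ∷ (1ℚ ∷ []) ∷ []) s       ≈⟨ eval-∷ [] ((1ℚ ∷ []) ∷ []) ⟩
    zeroS ⊕ s ⊗ evalXY ((1ℚ ∷ []) ∷ []) s ≈⟨ S.+-identityˡ _ ⟩
    s ⊗ evalXY ((1ℚ ∷ []) ∷ []) s        ≈⟨ S.*-congˡ (proj₂ (poly-polyS (1ℚ ∷ []))) ⟩
    s ⊗ polyS (1ℚ ∷ [])                  ≈⟨ S.*-congˡ (polyS-const 1ℚ) ⟩
    s ⊗ 1S                               ≈⟨ S.*-identityʳ s ⟩
    s                                    ∎)
    where open ≈-Reasoning

  -- Evenness of s leaves its powers alone, so x ↦ -x acts only on the coefficient polynomials.
  poly-tw : tw s ≈ s → ∀ {f} → IsPoly f → IsPoly (tw f)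
  poly-tw even (N , h) = map twP N , S.trans (eval-tw N) (tw-cong h)
    where
    eval-tw : ∀ N → evalXY (map twP N) s ≈ tw (evalXY N s)
    eval-tw []      n = sym (ℚₚ.*-zeroʳ (ε n))
    eval-tw (p ∷ N) = begin
      evalXY (twP p ∷ map twP N) s                  ≈⟨ eval-∷ (twP p) (map twP N) ⟩
      polyS (twP p) ⊕ s ⊗ evalXY (map twP N) s      ≈⟨ S.+-cong (polyS-twP p) (S.*-cong (S.sym even) (eval-tw N)) ⟩
      tw (polyS p) ⊕ tw s ⊗ tw (evalXY N s)         ≈⟨ S.+-congˡ (tw-* s (evalXY N s)) ⟨
      tw (polyS p) ⊕ tw (s ⊗ evalXY N s)            ≈⟨ tw-+ (polyS p) (s ⊗ evalXY N s) ⟨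
      tw (polyS p ⊕ s ⊗ evalXY N s)                 ≈⟨ tw-cong (eval-∷ p N) ⟨
      tw (evalXY (p ∷ N) s)                         ∎
      where open ≈-Reasoning

  -- The denominator is normalised to have constant term 1, so that it is a unit of ℚ[[x]].
  Good : Series → Set
  Good f = Σ Series λ d → IsPoly d × d 0 ≡ 1ℚ × IsPoly (d ⊗ f)

  good-resp : ∀ {f g} → f ≈ g → Good f → Good g
  good-resp e (d , pd , d0 , pf) = d , pd , d0 , poly-resp (S.*-congˡ {d} e) pf

  good-poly : ∀ {f} → IsPoly f → Good f
  good-poly {f} p = 1S , poly-const 1ℚ , refl , poly-resp (S.sym (S.*-identityˡ f)) p

  good-const : ∀ c → Good (constS c)
  good-const c = good-poly (poly-const c)

  good-zero : Good zeroS
  good-zero = good-poly ([] , λ _ → refl)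

  good-X : Good X
  good-X = good-poly (poly-polyS (0ℚ ∷ 1ℚ ∷ []))

  unit-* : ∀ {f g} → f 0 ≡ 1ℚ → g 0 ≡ 1ℚ → (f ⊗ g) 0 ≡ 1ℚ
  unit-* {f} {g} f0 g0 = trans (⊗-zero f g) (cong₂ _*_ f0 g0)

  good-+ : ∀ {f g} → Good f → Good g → Good (f ⊕ g)
  good-+ {f} {g} (d , pd , d0 , pf) (e , pe , e0 , pg) =
    d ⊗ e , poly-* pd pe , unit-* {d} {e} d0 e0 ,
    poly-resp (solve 4 (λ d e f g → (d :* f) :* e :+ d :* (e :* g) := (d :* e) :* (f :+ g)) (λ _ → refl) d e f g)
      (poly-+ (poly-* pf pe) (poly-* pd pg))
    where open S-Solver

  good-* : ∀ {f g} → Good f → Good g → Good (f ⊗ g)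
  good-* {f} {g} (d , pd , d0 , pf) (e , pe , e0 , pg) =
    d ⊗ e , poly-* pd pe , unit-* {d} {e} d0 e0 ,
    poly-resp (solve 4 (λ d e f g → (d :* f) :* (e :* g) := (d :* e) :* (f :* g)) (λ _ → refl) d e f g)
      (poly-* pf pg)
    where open S-Solver

  good-neg : ∀ {f} → Good f → Good (⊖ f)
  good-neg {f} gf = good-resp (solve 1 (λ a → con (- 1ℚ) :* a := :- a) (λ _ → refl) f) (good-* (good-const (- 1ℚ)) gf)
    where open S-Solver

  -- If d · u and e · (u · f) are polynomials in x and s, then e · (d · u) is a denominator of f
  -- with numerator d · (e · (u · f)). The constant term stays 1 because that of u is.
  good-÷ : ∀ {u f} → Good u → u 0 ≡ 1ℚ → Good (u ⊗ f) → Good f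
  good-÷ {u} {f} (d , pd , d0 , pu) u0 (e , pe , e0 , pf) =
    e ⊗ (d ⊗ u) , poly-* pe pu , unit-* {e} {d ⊗ u} e0 (unit-* {d} {u} d0 u0) ,
    poly-resp (solve 4 (λ d e u f → d :* (e :* (u :* f)) := (e :* (d :* u)) :* f) (λ _ → refl) d e u f)
      (poly-* pd pf)
    where open S-Solver

  good-sumTo : ∀ (h : ℕ → Series) n → (∀ i → i ≤ n → Good (h i)) → Good (λ j → sumTo (λ i → h i j) n)
  good-sumTo h zero    g = g 0 z≤n
  good-sumTo h (suc n) g =
    good-resp (⊕-at _ _) (good-+ (good-sumTo h n (λ i i≤n → g i (ℕₚ.m≤n⇒m≤1+n i≤n))) (g (suc n) ℕₚ.≤-refl))

  good-tw : tw s ≈ s → ∀ {f} → Good f → Good (tw f)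
  good-tw even {f} (d , pd , d0 , pf) =
    tw d , poly-tw even pd , trans (ℚₚ.*-identityˡ (d 0)) d0 ,
    poly-resp (tw-* d f) (poly-tw even pf)

  -- Together with its image under x ↦ -x the equation is a 2 × 2 linear system whose
  -- determinant has constant term 1.
  good-solve : tw s ≈ s → ∀ {K α β Y} → Good K → Good α → Good β →
    Y ≈ K ⊕ (X ⊗ ((α ⊗ Y) ⊕ (β ⊗ tw Y))) → Good Y
  good-solve even {K} {α} {β} {Y} gK gα gβ eq =
    good-÷ gdet det0 (good-resp (S.sym det-eq) grhs)
    where
    open S-Solver
    α' = tw α
    β' = tw β
    Y' = tw Y
    K' = tw K
    gα' = good-tw even gα
    gβ' = good-tw even gβ
    gK' = good-tw even gK
    -- The system reads v Y - Xβ Y' = K and Xβ' Y + u Y' = K'. Adding u times the first equation and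
    -- Xβ times the second eliminates Y'.
    u v det rhs : Series
    u   = 1S ⊕ (X ⊗ α')
    v   = 1S ⊕ (⊖ (X ⊗ α))
    det = (u ⊗ v) ⊕ ((X ⊗ X) ⊗ (β ⊗ β'))
    rhs = (u ⊗ K) ⊕ ((X ⊗ β) ⊗ K')
    gu : Good u
    gu = good-+ (good-const 1ℚ) (good-* good-X gα')
    gdet : Good det
    gdet = good-+ (good-* gu (good-+ (good-const 1ℚ) (good-neg (good-* good-X gα))))
                  (good-* (good-* good-X good-X) (good-* gβ gβ'))
    grhs : Good rhs
    grhs = good-+ (good-* gu gK) (good-* (good-* good-X gβ) gK')
    at0 : ∀ f g → f 0 ≡ 1ℚ → g 0 ≡ 0ℚ → (f ⊕ g) 0 ≡ 1ℚ
    at0 f g f0 g0 = trans (⊕-at f g 0) (cong₂ _+_ f0 g0)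
    det0 : det 0 ≡ 1ℚ
    det0 = at0 (u ⊗ v) _
      (unit-* {u} {v} (at0 1S (X ⊗ α') refl (X-⊗-zero α'))
                      (at0 1S (⊖ (X ⊗ α)) refl (trans (⊖-at (X ⊗ α) 0) (cong -_ (X-⊗-zero α)))))
      (trans (⊗-zero (X ⊗ X) (β ⊗ β')) (trans (cong (_* (β ⊗ β') 0) (⊗-zero X X)) (ℚₚ.*-zeroˡ ((β ⊗ β') 0))))
    eq' : Y' ≈ K' ⊕ ((⊖ X) ⊗ ((α' ⊗ Y') ⊕ (β' ⊗ Y)))
    eq' = begin
      tw Y                                                       ≈⟨ tw-cong eq ⟩
      tw (K ⊕ (X ⊗ ((α ⊗ Y) ⊕ (β ⊗ Y'))))                   ≈⟨ tw-+ K _ ⟩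
      K' ⊕ tw (X ⊗ ((α ⊗ Y) ⊕ (β ⊗ Y')))                    ≈⟨ S.+-congˡ {K'} (tw-* X _) ⟩
      K' ⊕ (tw X ⊗ tw ((α ⊗ Y) ⊕ (β ⊗ Y')))                 ≈⟨ S.+-congˡ {K'} (S.*-cong tw-X (S.trans (tw-+ (α ⊗ Y) (β ⊗ Y'))
                                                                      (S.+-cong (tw-* α Y) (S.trans (tw-* β Y') (S.*-congˡ {β'} (tw-involutive Y)))))) ⟩
      K' ⊕ ((⊖ X) ⊗ ((α' ⊗ Y') ⊕ (β' ⊗ Y)))                ∎
      where open ≈-Reasoning
    E₁ E₂ : Series
    E₁ = K ⊕ (X ⊗ ((α ⊗ Y) ⊕ (β ⊗ Y')))
    E₂ = K' ⊕ ((⊖ X) ⊗ ((α' ⊗ Y') ⊕ (β' ⊗ Y)))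
    det-eq : det ⊗ Y ≈ rhs
    det-eq = begin
      det ⊗ Y
        ≈⟨ solve 9 (λ x a b a' b' y y' k k' →
             ((con 1ℚ :+ x :* a') :* (con 1ℚ :+ :- (x :* a)) :+ (x :* x) :* (b :* b')) :* y :=
             ((con 1ℚ :+ x :* a') :* k :+ (x :* b) :* k')
               :+ (con 1ℚ :+ x :* a') :* (y :- (k :+ x :* (a :* y :+ b :* y')))
               :+ (x :* b) :* (y' :- (k' :+ (:- x) :* (a' :* y' :+ b' :* y))))
             (λ _ → refl) X α β α' β' Y Y' K K' ⟩
      (rhs ⊕ (u ⊗ (Y ⊕ (⊖ E₁)))) ⊕ ((X ⊗ β) ⊗ (Y' ⊕ (⊖ E₂)))
        ≈⟨ S.+-cong (S.+-congˡ {rhs} (S.*-congˡ {u} (diff eq))) (S.*-congˡ {X ⊗ β} (diff eq')) ⟩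
      (rhs ⊕ (u ⊗ zeroS)) ⊕ ((X ⊗ β) ⊗ zeroS)
        ≈⟨ S.+-cong (S.+-congˡ {rhs} (S.zeroʳ u)) (S.zeroʳ (X ⊗ β)) ⟩
      (rhs ⊕ zeroS) ⊕ zeroS
        ≈⟨ S.trans (S.+-identityʳ _) (S.+-identityʳ rhs) ⟩
      rhs ∎
      where
      open ≈-Reasoning
      diff : ∀ {f g} → f ≈ g → f ⊕ (⊖ g) ≈ zeroS
      diff {f} {g} e = S.trans (S.+-congʳ {x = ⊖ g} e) (S.-‿inverseʳ g)

-- The root of 1 - 4x² and the quadratic equation

4ℚ : ℚ
4ℚ = ℤ.+ 4 / 1

oneMinus4x²-eq : oneMinus4x² ≈ 1S ⊕ ⊖ (constS 4ℚ ⊗ (X ⊗ X))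
oneMinus4x²-eq = begin
  oneMinus4x²
    ≈⟨ (λ { 0 → refl ; 1 → refl ; 2 → refl ; (suc (suc (suc n))) → refl }) ⟩
  polyS (1ℚ ∷ 0ℚ ∷ (- 4ℚ) ∷ [])
    ≈⟨ S.trans (polyS-∷ 1ℚ _) (S.+-congˡ (S.*-congˡ (S.trans (polyS-∷ 0ℚ _) (S.+-congˡ (S.*-congˡ (polyS-const (- 4ℚ))))))) ⟩
  1S ⊕ X ⊗ (constS 0ℚ ⊕ X ⊗ constS (- 4ℚ))
    ≈⟨ solve 1 (λ x → con 1ℚ :+ x :* (con 0ℚ :+ x :* con (- 4ℚ)) := con 1ℚ :- con 4ℚ :* (x :* x)) (λ _ → refl) X ⟩
  1S ⊕ ⊖ (constS 4ℚ ⊗ (X ⊗ X)) ∎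
  where open ≈-Reasoning
        open S-Solver

tw-oneMinus4x² : tw oneMinus4x² ≈ oneMinus4x²
tw-oneMinus4x² 0 = refl
tw-oneMinus4x² 1 = refl
tw-oneMinus4x² 2 = refl
tw-oneMinus4x² (suc (suc (suc n))) = ℚₚ.*-zeroʳ (ε (suc (suc (suc n))))

module Sqrt (s : Series) (s0 : s 0 ≡ 1ℚ) (s² : s ⊗ s ≈ oneMinus4x²) where

  open Poly s public

  -- Since 1 - 4x² is even, `tw s` is another root of it with constant term 1.
  even : tw s ≈ s
  even = sqrt-unique (tw s) s (trans (ℚₚ.*-identityˡ (s 0)) s0) s0 (begin
    tw s ⊗ tw s       ≈⟨ tw-* s s ⟨
    tw (s ⊗ s)        ≈⟨ tw-cong s² ⟩
    tw oneMinus4x²    ≈⟨ tw-oneMinus4x² ⟩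
    oneMinus4x²       ≈⟨ s² ⟨
    s ⊗ s             ∎)
    where open ≈-Reasoning

  -- The odd series y = a - 1 satisfies y = x (1 + y²), hence s = 1 - 2xy and (1 + s) y = 2x.
  good-base : ∀ {a} → a ≈ 1S ⊕ X ⊗ (constS ½ ⊗ (a ⊗ a ⊕ tw a ⊗ tw a)) → Good a
  good-base {a} eq = good-resp y+1 (good-+ gy (good-const 1ℚ))
    where
    open ≈-Reasoning
    open S-Solver
    2ℚ = 1ℚ + 1ℚ
    b y sq s' u : Series
    b  = tw a
    y  = a ⊕ ⊖ 1S
    sq = constS ½ ⊗ (a ⊗ a ⊕ b ⊗ b)
    s' = 1S ⊕ ⊖ (constS 2ℚ ⊗ (X ⊗ y))
    u  = constS ½ ⊗ (1S ⊕ s)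

    y+1 : y ⊕ 1S ≈ a
    y+1 = solve 1 (λ a → a :- con 1ℚ :+ con 1ℚ := a) (λ _ → refl) a

    -- Replacing x by -x swaps a and b, so `sq` is even and y = X · `sq` is odd.
    tw-sq : tw sq ≈ sq
    tw-sq = begin
      tw sq                                   ≈⟨ tw-* (constS ½) (a ⊗ a ⊕ b ⊗ b) ⟩
      tw (constS ½) ⊗ tw (a ⊗ a ⊕ b ⊗ b)      ≈⟨ S.*-cong (tw-const ½) (tw-+ (a ⊗ a) (b ⊗ b)) ⟩
      constS ½ ⊗ (tw (a ⊗ a) ⊕ tw (b ⊗ b))    ≈⟨ S.*-congˡ (S.+-cong (tw-* a a) (S.trans (tw-* b b) (S.*-cong (tw-involutive a) (tw-involutive a)))) ⟩
      constS ½ ⊗ (b ⊗ b ⊕ a ⊗ a)              ≈⟨ S.*-congˡ (S.+-comm (b ⊗ b) (a ⊗ a)) ⟩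
      sq                                      ∎

    b-eq : b ≈ 1S ⊕ ⊖ X ⊗ sq
    b-eq = begin
      tw a                        ≈⟨ tw-cong eq ⟩
      tw (1S ⊕ X ⊗ sq)            ≈⟨ tw-+ 1S (X ⊗ sq) ⟩
      tw 1S ⊕ tw (X ⊗ sq)         ≈⟨ S.+-cong (tw-const 1ℚ) (tw-* X sq) ⟩
      1S ⊕ tw X ⊗ tw sq           ≈⟨ S.+-congˡ (S.*-cong tw-X tw-sq) ⟩
      1S ⊕ ⊖ X ⊗ sq               ∎

    b≈1-y : b ≈ 1S ⊕ ⊖ y
    b≈1-y = begin
      b                                 ≈⟨ b-eq ⟩
      1S ⊕ ⊖ X ⊗ sq                     ≈⟨ solve 2 (λ x q → con 1ℚ :+ (:- x) :* q := con 1ℚ :- (con 1ℚ :+ x :* q :- con 1ℚ)) (λ _ → refl) X sq ⟩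
      1S ⊕ ⊖ ((1S ⊕ X ⊗ sq) ⊕ ⊖ 1S)     ≈⟨ S.+-congˡ (S.-‿cong (S.+-congʳ eq)) ⟨
      1S ⊕ ⊖ y                          ∎

    y-eq : y ≈ X ⊗ (1S ⊕ y ⊗ y)
    y-eq = begin
      a ⊕ ⊖ 1S                                                    ≈⟨ S.+-congʳ eq ⟩
      (1S ⊕ X ⊗ sq) ⊕ ⊖ 1S                                        ≈⟨ solve 2 (λ x q → con 1ℚ :+ x :* q :- con 1ℚ := x :* q) (λ _ → refl) X sq ⟩
      X ⊗ (constS ½ ⊗ (a ⊗ a ⊕ b ⊗ b))                            ≈⟨ S.*-congˡ (S.*-congˡ (S.+-congˡ (S.*-cong b≈1-y b≈1-y))) ⟩
      X ⊗ (constS ½ ⊗ (a ⊗ a ⊕ (1S ⊕ ⊖ y) ⊗ (1S ⊕ ⊖ y)))          ≈⟨ solve 2 (λ x a → x :* (con ½ :* (a :* a :+ (con 1ℚ :- (a :- con 1ℚ)) :* (con 1ℚ :- (a :- con 1ℚ))))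
                                                                       := x :* (con 1ℚ :+ (a :- con 1ℚ) :* (a :- con 1ℚ))) (λ _ → refl) X a ⟩
      X ⊗ (1S ⊕ y ⊗ y)                                            ∎

    s'-sq : s' ⊗ s' ≈ oneMinus4x²
    s'-sq = begin
      s' ⊗ s'
        ≈⟨ solve 2 (λ x y → (con 1ℚ :- con 2ℚ :* (x :* y)) :* (con 1ℚ :- con 2ℚ :* (x :* y))
             := (con 1ℚ :- con 4ℚ :* (x :* y)) :+ con 4ℚ :* (x :* x :* (y :* y))) (λ _ → refl) X y ⟩
      (1S ⊕ ⊖ (constS 4ℚ ⊗ (X ⊗ y))) ⊕ constS 4ℚ ⊗ (X ⊗ X ⊗ (y ⊗ y))
        ≈⟨ S.+-congʳ (S.+-congˡ (S.-‿cong (S.*-congˡ (S.*-congˡ y-eq)))) ⟩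
      (1S ⊕ ⊖ (constS 4ℚ ⊗ (X ⊗ (X ⊗ (1S ⊕ y ⊗ y))))) ⊕ constS 4ℚ ⊗ (X ⊗ X ⊗ (y ⊗ y))
        ≈⟨ solve 2 (λ x y → (con 1ℚ :- con 4ℚ :* (x :* (x :* (con 1ℚ :+ y :* y)))) :+ con 4ℚ :* (x :* x :* (y :* y))
             := con 1ℚ :- con 4ℚ :* (x :* x)) (λ _ → refl) X y ⟩
      1S ⊕ ⊖ (constS 4ℚ ⊗ (X ⊗ X))
        ≈⟨ oneMinus4x²-eq ⟨
      oneMinus4x² ∎

    s'0 : s' 0 ≡ 1ℚ
    s'0 = trans (⊕-at 1S _ 0) (cong (1ℚ +_) (trans (⊖-at (constS 2ℚ ⊗ (X ⊗ y)) 0) (cong -_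
      (trans (⊗-zero (constS 2ℚ) (X ⊗ y)) (trans (cong (2ℚ *_) (X-⊗-zero y)) (ℚₚ.*-zeroʳ 2ℚ))))))

    s≈s' : s ≈ s'
    s≈s' = sqrt-unique s s' s0 s'0 (S.trans s² (S.sym s'-sq))

    -- The formula y = (1 - s)/(2x) has a denominator without constant term; multiplying through by
    -- 1 + s gives u y = x with u a unit. After multiplication by X this is (1 - s²)/4 = x², because
    -- X y = (1 - s)/2.
    uy : u ⊗ y ≈ X
    uy = X-cancel (u ⊗ y) X (begin
      X ⊗ (u ⊗ y)
        ≈⟨ solve 3 (λ x s y → x :* (con ½ :* (con 1ℚ :+ s) :* y)
             := con (½ * ½) :* (con 1ℚ :- s :* s)
                  :- con (½ * ½) :* (con 1ℚ :+ s) :* ((con 1ℚ :- con 2ℚ :* (x :* y)) :- s)) (λ _ → refl) X s y ⟩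
      constS (½ * ½) ⊗ (1S ⊕ ⊖ (s ⊗ s)) ⊕ ⊖ (constS (½ * ½) ⊗ (1S ⊕ s) ⊗ (s' ⊕ ⊖ s))
        ≈⟨ S.+-cong (S.*-congˡ (S.+-congˡ (S.-‿cong (S.trans s² oneMinus4x²-eq))))
                    (S.-‿cong (S.*-congˡ (S.trans (S.+-congʳ (S.sym s≈s')) (S.-‿inverseʳ s)))) ⟩
      constS (½ * ½) ⊗ (1S ⊕ ⊖ (1S ⊕ ⊖ (constS 4ℚ ⊗ (X ⊗ X)))) ⊕ ⊖ (constS (½ * ½) ⊗ (1S ⊕ s) ⊗ zeroS)
        ≈⟨ S.+-congˡ (S.-‿cong (S.*-congˡ constS-0)) ⟨
      constS (½ * ½) ⊗ (1S ⊕ ⊖ (1S ⊕ ⊖ (constS 4ℚ ⊗ (X ⊗ X)))) ⊕ ⊖ (constS (½ * ½) ⊗ (1S ⊕ s) ⊗ constS 0ℚ)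
        ≈⟨ solve 2 (λ x s → con (½ * ½) :* (con 1ℚ :- (con 1ℚ :- con 4ℚ :* (x :* x))) :- con (½ * ½) :* (con 1ℚ :+ s) :* con 0ℚ
             := x :* x) (λ _ → refl) X s ⟩
      X ⊗ X ∎)

    gy : Good y
    gy = good-÷ {u} {y}
      (good-* (good-const ½) (good-+ (good-const 1ℚ) (good-poly poly-s)))
      (trans (⊗-zero (constS ½) (1S ⊕ s)) (cong (½ *_) (trans (⊕-at 1S s 0) (cong (1ℚ +_) s0))))
      (good-resp (S.sym uy) good-X)

-- States of a permutation and path series

-- A word records which values a prefix of a permutation has used (true = used), with the
-- largest value at the head.
Word : Set
Word = List Bool

ones : Word → ℕ
ones []          = 0
ones (true ∷ t)  = suc (ones t)
ones (false ∷ t) = ones t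

zeros : Word → ℕ
zeros []          = 0
zeros (true ∷ t)  = zeros t
zeros (false ∷ t) = suc (zeros t)

area : Word → ℕ
area []          = 0
area (true ∷ t)  = area t
area (false ∷ t) = ones t ℕ.+ area t

-- Here `X` plays the role of q, which counts occurrences. The variable x, which counts values,
-- enters only with `coeffQ`, where the two indices are exchanged.
q^ : ℕ → Series
q^ zero    = 1S
q^ (suc a) = X ⊗ q^ a

-- Using the value just above those of t creates zeros t inversions, and area t occurrences
-- of 132 in which it plays the role of 3.
wt : Word → Series
wt t = constS (ε (zeros t)) ⊗ q^ (area t)

sumWS : ℕ → (Word → Series) → Series
sumWS zero    F = F []
sumWS (suc n) F = sumWS n (F ∘ (false ∷_)) ⊕ sumWS n (F ∘ (true ∷_))

-- The generating function (in q, with signs) of the ways to get from u to v by using one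
-- value at a time.  If the largest value is among those used, t is the state of the
-- other values at that moment.
P : ℕ → Word → Word → Series
P zero    []          []          = 1S
P (suc n) (false ∷ u) (false ∷ v) = P n u v
P (suc n) (true ∷ u)  (true ∷ v)  = P n u v
P (suc n) (false ∷ u) (true ∷ v)  = sumWS n (λ t → P n u t ⊗ (wt t ⊗ P n t v))
P _       _           _           = zeroS

sumWS-cong : ∀ n {F G : Word → Series} → (∀ t → length t ≡ n → F t ≈ G t) → sumWS n F ≈ sumWS n G
sumWS-cong zero    e = e [] refl
sumWS-cong (suc n) e =
  S.+-cong (sumWS-cong n (λ t l → e (false ∷ t) (cong suc l))) (sumWS-cong n (λ t l → e (true ∷ t) (cong suc l)))

sumWS-zero : ∀ n {F : Word → Series} → (∀ t → length t ≡ n → F t ≈ zeroS) → sumWS n F ≈ zeroS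
sumWS-zero zero    e = e [] refl
sumWS-zero (suc n) e = S.trans
  (S.+-cong (sumWS-zero n (λ t l → e (false ∷ t) (cong suc l))) (sumWS-zero n (λ t l → e (true ∷ t) (cong suc l))))
  (S.+-identityʳ zeroS)

⊕-interchange : ∀ a b c d → (a ⊕ b) ⊕ (c ⊕ d) ≈ (a ⊕ c) ⊕ (b ⊕ d)
⊕-interchange = solve 4 (λ a b c d → (a :+ b) :+ (c :+ d) := (a :+ c) :+ (b :+ d)) (λ _ → refl)
  where open S-Solver

sumWS-⊕ : ∀ n (F G : Word → Series) → sumWS n (λ t → F t ⊕ G t) ≈ sumWS n F ⊕ sumWS n G
sumWS-⊕ zero    F G = S.refl
sumWS-⊕ (suc n) F G = S.trans
  (S.+-cong (sumWS-⊕ n (F ∘ (false ∷_)) (G ∘ (false ∷_))) (sumWS-⊕ n (F ∘ (true ∷_)) (G ∘ (true ∷_))))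
  (⊕-interchange _ _ _ _)

sumWS-⊗ : ∀ n c (F : Word → Series) → sumWS n (λ t → c ⊗ F t) ≈ c ⊗ sumWS n F
sumWS-⊗ zero    c F = S.refl
sumWS-⊗ (suc n) c F = S.trans
  (S.+-cong (sumWS-⊗ n c (F ∘ (false ∷_))) (sumWS-⊗ n c (F ∘ (true ∷_)))) (S.sym (S.distribˡ c _ _))

sumWS-∷ʳ : ∀ n (F : Word → Series) →
  sumWS (suc n) F ≈ sumWS n (λ t → F (t ++ false ∷ [])) ⊕ sumWS n (λ t → F (t ++ true ∷ []))
sumWS-∷ʳ zero    F = S.refl
sumWS-∷ʳ (suc n) F = S.trans
  (S.+-cong (sumWS-∷ʳ n (F ∘ (false ∷_))) (sumWS-∷ʳ n (F ∘ (true ∷_)))) (⊕-interchange _ _ _ _)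

P-lengthˡ : ∀ n u v → length u ≢ n → P n u v ≈ zeroS
P-lengthˡ zero    []          v           l = contradiction refl l
P-lengthˡ zero    (_ ∷ u)     v           l = S.refl
P-lengthˡ (suc n) []          v           l = S.refl
P-lengthˡ (suc n) (false ∷ u) []          l = S.refl
P-lengthˡ (suc n) (true ∷ u)  []          l = S.refl
P-lengthˡ (suc n) (false ∷ u) (false ∷ v) l = P-lengthˡ n u v (l ∘ cong suc)
P-lengthˡ (suc n) (true ∷ u)  (true ∷ v)  l = P-lengthˡ n u v (l ∘ cong suc)
P-lengthˡ (suc n) (true ∷ u)  (false ∷ v) l = S.refl
P-lengthˡ (suc n) (false ∷ u) (true ∷ v)  l = sumWS-zero n λ t _ →
  S.trans (S.*-congʳ (P-lengthˡ n u t (l ∘ cong suc))) (S.zeroˡ _)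

P-lengthʳ : ∀ n u v → length v ≢ n → P n u v ≈ zeroS
P-lengthʳ zero    u           []          l = contradiction refl l
P-lengthʳ zero    []          (_ ∷ v)     l = S.refl
P-lengthʳ zero    (_ ∷ u)     (_ ∷ v)     l = S.refl
P-lengthʳ (suc n) []          v           l = S.refl
P-lengthʳ (suc n) (false ∷ u) []          l = S.refl
P-lengthʳ (suc n) (true ∷ u)  []          l = S.refl
P-lengthʳ (suc n) (false ∷ u) (false ∷ v) l = P-lengthʳ n u v (l ∘ cong suc)
P-lengthʳ (suc n) (true ∷ u)  (true ∷ v)  l = P-lengthʳ n u v (l ∘ cong suc)
P-lengthʳ (suc n) (true ∷ u)  (false ∷ v) l = S.refl
P-lengthʳ (suc n) (false ∷ u) (true ∷ v)  l = sumWS-zero n λ t _ →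
  S.trans (S.*-congˡ (S.trans (S.*-congˡ (P-lengthʳ n t v (l ∘ cong suc))) (S.zeroʳ (wt t)))) (S.zeroʳ _)

-- Decomposition with respect to the first value used

-- The sum over all single steps from a state. The values above the one being used do not affect its
-- weight, so they are merely passed on to `G`.
steps : Word → (Word → Series) → Series
steps []          G = zeroS
steps (true ∷ t)  G = steps t (G ∘ (true ∷_))
steps (false ∷ t) G = wt t ⊗ G (true ∷ t) ⊕ steps t (G ∘ (false ∷_))

δ : Word → Word → Series
δ []          []          = 1S
δ (false ∷ u) (false ∷ v) = δ u v
δ (true ∷ u)  (true ∷ v)  = δ u v
δ _           _           = zeroS

steps-zero : ∀ u {G} → (∀ t → G t ≈ zeroS) → steps u G ≈ zeroS
steps-zero []          e = S.refl
steps-zero (true ∷ t)  e = steps-zero t (e ∘ (true ∷_))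
steps-zero (false ∷ t) e = S.trans
  (S.+-cong (S.trans (S.*-congˡ (e (true ∷ t))) (S.zeroʳ (wt t))) (steps-zero t (e ∘ (false ∷_))))
  (S.+-identityʳ zeroS)

steps-⊗ : ∀ u (G : Word → Series) x → steps u (λ t → G t ⊗ x) ≈ steps u G ⊗ x
steps-⊗ []          G x = S.sym (S.zeroˡ x)
steps-⊗ (true ∷ t)  G x = steps-⊗ t (G ∘ (true ∷_)) x
steps-⊗ (false ∷ t) G x = S.trans
  (S.+-cong (S.sym (S.*-assoc (wt t) (G (true ∷ t)) x)) (steps-⊗ t (G ∘ (false ∷_)) x))
  (S.sym (S.distribʳ x _ _))

steps-sumWS : ∀ n u (F : Word → Word → Series) →
  steps u (λ t → sumWS n (F t)) ≈ sumWS n (λ t' → steps u (λ t → F t t'))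
steps-sumWS n []          F = S.sym (sumWS-zero n (λ _ _ → S.refl))
steps-sumWS n (true ∷ t)  F = steps-sumWS n t (F ∘ (true ∷_))
steps-sumWS n (false ∷ t) F = S.trans
  (S.+-cong (S.sym (sumWS-⊗ n (wt t) (F (true ∷ t)))) (steps-sumWS n t (F ∘ (false ∷_))))
  (S.sym (sumWS-⊕ n _ _))

sumWS-δ : ∀ n u (H : Word → Series) → length u ≡ n → sumWS n (λ t → δ u t ⊗ H t) ≈ H u
sumWS-δ zero    []          H l = S.*-identityˡ (H [])
sumWS-δ (suc n) (false ∷ u) H l = S.trans
  (S.+-cong (sumWS-δ n u (H ∘ (false ∷_)) (ℕₚ.suc-injective l)) (sumWS-zero n (λ t _ → S.zeroˡ _)))
  (S.+-identityʳ _)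
sumWS-δ (suc n) (true ∷ u) H l = S.trans
  (S.+-cong (sumWS-zero n (λ t _ → S.zeroˡ _)) (sumWS-δ n u (H ∘ (true ∷_)) (ℕₚ.suc-injective l)))
  (S.+-identityˡ _)

-- `P` splits a path where the largest value is used, whereas a permutation is read letter by
-- letter; this connects the two. When the largest value gets used, the first step is either that
-- one (the `δ` part of the sum over t) or a step of the part before it.
P-first : ∀ n u v → length u ≡ n → P n u v ≈ δ u v ⊕ steps u (λ u' → P n u' v)
P-first zero    []          []          l = S.sym (S.+-identityʳ 1S)
P-first zero    []          (_ ∷ v)     l = S.sym (S.+-identityʳ zeroS)
P-first (suc n) (false ∷ u) []          l = S.sym (S.trans (S.+-identityˡ _) (S.trans
  (S.+-cong (S.zeroʳ (wt u)) (steps-zero u (λ _ → S.refl))) (S.+-identityʳ zeroS)))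
P-first (suc n) (true ∷ u)  []          l = S.sym (S.trans (S.+-identityˡ _) (steps-zero u (λ _ → S.refl)))
P-first (suc n) (true ∷ u)  (false ∷ v) l = S.sym (S.trans (S.+-identityˡ _) (steps-zero u (λ _ → S.refl)))
P-first (suc n) (true ∷ u)  (true ∷ v)  l = P-first n u v (ℕₚ.suc-injective l)
P-first (suc n) (false ∷ u) (false ∷ v) l = S.trans (P-first n u v (ℕₚ.suc-injective l))
  (S.+-congˡ (S.sym (S.trans (S.+-congʳ (S.zeroʳ (wt u))) (S.+-identityˡ _))))
P-first (suc n) (false ∷ u) (true ∷ v)  l = begin
  sumWS n (λ t → P n u t ⊗ R t)
    ≈⟨ sumWS-cong n (λ t _ → S.trans (S.*-congʳ (P-first n u t (ℕₚ.suc-injective l))) (S.distribʳ (R t) _ _)) ⟩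
  sumWS n (λ t → δ u t ⊗ R t ⊕ steps u (λ u' → P n u' t) ⊗ R t)
    ≈⟨ sumWS-⊕ n _ _ ⟩
  sumWS n (λ t → δ u t ⊗ R t) ⊕ sumWS n (λ t → steps u (λ u' → P n u' t) ⊗ R t)
    ≈⟨ S.+-cong (sumWS-δ n u R (ℕₚ.suc-injective l)) (sumWS-cong n (λ t _ → S.sym (steps-⊗ u (λ u' → P n u' t) (R t)))) ⟩
  R u ⊕ sumWS n (λ t → steps u (λ u' → P n u' t ⊗ R t))
    ≈⟨ S.+-congˡ (S.sym (steps-sumWS n u (λ u' t → P n u' t ⊗ R t))) ⟩
  R u ⊕ steps u (λ u' → sumWS n (λ t → P n u' t ⊗ R t))
    ≈⟨ S.+-identityˡ _ ⟨
  zeroS ⊕ (R u ⊕ steps u (λ u' → sumWS n (λ t → P n u' t ⊗ R t))) ∎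
  where
  open ≈-Reasoning
  R : Word → Series
  R t = wt t ⊗ P n t v

-- Unused values below all others only contribute signs

ones-∷ʳ : ∀ t → ones (t ++ false ∷ []) ≡ ones t
ones-∷ʳ []          = refl
ones-∷ʳ (true ∷ t)  = cong suc (ones-∷ʳ t)
ones-∷ʳ (false ∷ t) = ones-∷ʳ t

zeros-∷ʳ : ∀ t → zeros (t ++ false ∷ []) ≡ suc (zeros t)
zeros-∷ʳ []          = refl
zeros-∷ʳ (true ∷ t)  = zeros-∷ʳ t
zeros-∷ʳ (false ∷ t) = cong suc (zeros-∷ʳ t)

area-∷ʳ : ∀ t → area (t ++ false ∷ []) ≡ area t
area-∷ʳ []          = refl
area-∷ʳ (true ∷ t)  = area-∷ʳ t
area-∷ʳ (false ∷ t) = cong₂ ℕ._+_ (ones-∷ʳ t) (area-∷ʳ t)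

P-∷ʳ-10 : ∀ n u v → P (suc n) (u ++ true ∷ []) (v ++ false ∷ []) ≈ zeroS
P-∷ʳ-10 zero    []          []          = S.refl
P-∷ʳ-10 zero    []          (true ∷ v)  = P-lengthʳ 0 [] (v ++ false ∷ []) (len v)
  where
  len : ∀ v → length (v ++ false ∷ []) ≢ 0
  len [] ()
  len (_ ∷ _) ()
P-∷ʳ-10 zero    []          (false ∷ v) = S.refl
P-∷ʳ-10 zero    (a ∷ u)     v           = P-lengthˡ 1 (a ∷ u ++ true ∷ []) (v ++ false ∷ []) (len u)
  where
  len : ∀ u → suc (length (u ++ true ∷ [])) ≢ 1
  len [] ()
  len (_ ∷ _) ()
P-∷ʳ-10 (suc n) []          (true ∷ v)  = S.refl
P-∷ʳ-10 (suc n) []          (false ∷ v) = S.refl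
P-∷ʳ-10 (suc n) []          []          = S.refl
P-∷ʳ-10 (suc n) (true ∷ u)  []          = S.refl
P-∷ʳ-10 (suc n) (false ∷ u) []          = P-lengthʳ (suc n) (u ++ true ∷ []) [] (λ ())
P-∷ʳ-10 (suc n) (true ∷ u)  (true ∷ v)  = P-∷ʳ-10 n u v
P-∷ʳ-10 (suc n) (true ∷ u)  (false ∷ v) = S.refl
P-∷ʳ-10 (suc n) (false ∷ u) (false ∷ v) = P-∷ʳ-10 n u v
P-∷ʳ-10 (suc n) (false ∷ u) (true ∷ v)  = begin
  sumWS (suc n) F
    ≈⟨ sumWS-∷ʳ n F ⟩
  sumWS n (λ t → F (t ++ false ∷ [])) ⊕ sumWS n (λ t → F (t ++ true ∷ []))
    ≈⟨ S.+-cong (sumWS-zero n λ t _ → S.trans (S.*-congʳ (P-∷ʳ-10 n u t)) (S.zeroˡ _))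
                (sumWS-zero n λ t _ → S.trans (S.*-congˡ (S.trans (S.*-congˡ (P-∷ʳ-10 n t v)) (S.zeroʳ _))) (S.zeroʳ _)) ⟩
  zeroS ⊕ zeroS
    ≈⟨ S.+-identityʳ zeroS ⟩
  zeroS ∎
  where
  open ≈-Reasoning
  F : Word → Series
  F t = P (suc n) (u ++ true ∷ []) t ⊗ (wt t ⊗ P (suc n) t (v ++ false ∷ []))

cε : ℕ → Series
cε k = constS (ε k)

cε-+ : ∀ j k → cε (j ℕ.+ k) ≈ cε j ⊗ cε k
cε-+ j k = S.trans (λ n → cong (λ c → constS c n) (ε-+ j k)) (constS-* (ε j) (ε k))

cε-suc : ∀ k → cε (suc k) ≈ ⊖ cε k
cε-suc k = constS-neg (ε k)

cε-square : ∀ k → cε k ⊗ cε k ≈ 1S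
cε-square k = S.trans (S.sym (constS-* (ε k) (ε k))) (λ n → cong (λ c → constS c n) (ε-square k))

-- The extra value lies below every value used on the way, so each step gains one inversion and no
-- occurrence. The number of steps is `ones v` - `ones u`, which has the parity of the sum; the sum
-- avoids truncated subtraction.
P-∷ʳ-00 : ∀ n u v → length u ≡ n → length v ≡ n →
  P (suc n) (u ++ false ∷ []) (v ++ false ∷ []) ≈ cε (ones u ℕ.+ ones v) ⊗ P n u v
P-∷ʳ-00 zero    []          []          l l' = S.sym (S.*-identityˡ 1S)
P-∷ʳ-00 (suc n) (true ∷ u)  (false ∷ v) l l' = S.sym (S.zeroʳ _)
P-∷ʳ-00 (suc n) (false ∷ u) (false ∷ v) l l' = P-∷ʳ-00 n u v (ℕₚ.suc-injective l) (ℕₚ.suc-injective l')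
P-∷ʳ-00 (suc n) (true ∷ u)  (true ∷ v)  l l' = begin
  P (suc n) (u ++ false ∷ []) (v ++ false ∷ [])
    ≈⟨ P-∷ʳ-00 n u v (ℕₚ.suc-injective l) (ℕₚ.suc-injective l') ⟩
  cε (ones u ℕ.+ ones v) ⊗ P n u v
    ≈⟨ S.*-congʳ (λ k → cong (λ c → constS c k) parity) ⟩
  cε (suc (ones u) ℕ.+ suc (ones v)) ⊗ P n u v ∎
  where
  open ≈-Reasoning
  parity : ε (ones u ℕ.+ ones v) ≡ ε (suc (ones u) ℕ.+ suc (ones v))
  parity = sym (trans (cong (λ k → - ε k) (ℕₚ.+-suc (ones u) (ones v))) (ℚ-Solver.solve 1 (λ a → ℚ-Solver._:=_ (ℚ-Solver.:-_ (ℚ-Solver.:-_ a)) a) refl (ε (ones u ℕ.+ ones v))))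
P-∷ʳ-00 (suc n) (false ∷ u) (true ∷ v)  l l' = begin
  sumWS (suc n) F
    ≈⟨ sumWS-∷ʳ n F ⟩
  sumWS n (λ t → F (t ++ false ∷ [])) ⊕ sumWS n (λ t → F (t ++ true ∷ []))
    ≈⟨ S.+-cong (sumWS-cong n term) (sumWS-zero n λ t _ →
         S.trans (S.*-congˡ (S.trans (S.*-congˡ (P-∷ʳ-10 n t v)) (S.zeroʳ _))) (S.zeroʳ _)) ⟩
  sumWS n (λ t → cε (ones u ℕ.+ suc (ones v)) ⊗ (P n u t ⊗ (wt t ⊗ P n t v))) ⊕ zeroS
    ≈⟨ S.trans (S.+-identityʳ _) (sumWS-⊗ n _ _) ⟩
  cε (ones u ℕ.+ suc (ones v)) ⊗ sumWS n (λ t → P n u t ⊗ (wt t ⊗ P n t v)) ∎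
  where
  open ≈-Reasoning
  F : Word → Series
  F t = P (suc n) (u ++ false ∷ []) t ⊗ (wt t ⊗ P (suc n) t (v ++ false ∷ []))
  wt-∷ʳ : ∀ t → wt (t ++ false ∷ []) ≈ ⊖ cε (zeros t) ⊗ q^ (area t)
  wt-∷ʳ t rewrite zeros-∷ʳ t | area-∷ʳ t = S.*-congʳ (cε-suc (zeros t))
  term : ∀ t → length t ≡ n →
    F (t ++ false ∷ []) ≈ cε (ones u ℕ.+ suc (ones v)) ⊗ (P n u t ⊗ (wt t ⊗ P n t v))
  term t lt = begin
    F (t ++ false ∷ [])
      ≈⟨ S.*-cong (S.trans (P-∷ʳ-00 n u t (ℕₚ.suc-injective l) lt) (S.*-congʳ (cε-+ (ones u) (ones t))))
           (S.*-cong (wt-∷ʳ t) (S.trans (P-∷ʳ-00 n t v lt (ℕₚ.suc-injective l')) (S.*-congʳ (cε-+ (ones t) (ones v))))) ⟩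
    (cε (ones u) ⊗ cε (ones t) ⊗ P n u t) ⊗
      ((⊖ cε (zeros t) ⊗ q^ (area t)) ⊗ (cε (ones t) ⊗ cε (ones v) ⊗ P n t v))
      ≈⟨ solve 7 (λ a b c p z q r → (a :* b :* p) :* (((:- z) :* q) :* (b :* c :* r)) :=
                                    (b :* b) :* (a :* (:- c) :* (p :* ((z :* q) :* r)))) (λ _ → refl)
           (cε (ones u)) (cε (ones t)) (cε (ones v)) (P n u t) (cε (zeros t)) (q^ (area t)) (P n t v) ⟩
    (cε (ones t) ⊗ cε (ones t)) ⊗ (cε (ones u) ⊗ ⊖ cε (ones v) ⊗ (P n u t ⊗ (wt t ⊗ P n t v)))
      ≈⟨ S.trans (S.*-congʳ (cε-square (ones t))) (S.*-identityˡ _) ⟩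
    cε (ones u) ⊗ ⊖ cε (ones v) ⊗ (P n u t ⊗ (wt t ⊗ P n t v))
      ≈⟨ S.*-congʳ (S.trans (cε-+ (ones u) (suc (ones v))) (S.*-congˡ (cε-suc (ones v)))) ⟨
    cε (ones u ℕ.+ suc (ones v)) ⊗ (P n u t ⊗ (wt t ⊗ P n t v)) ∎
    where open S-Solver

pad : Word → ℕ → Word
pad t i = t ++ replicate i false

pad-suc : ∀ t i → pad t (suc i) ≡ pad (t ++ false ∷ []) i
pad-suc t i = sym (Listₚ.++-assoc t (false ∷ []) (replicate i false))

length-∷ʳ : ∀ (t : Word) b → length (t ++ b ∷ []) ≡ suc (length t)
length-∷ʳ t b = trans (Listₚ.length-++ t) (ℕₚ.+-comm (length t) 1)

P-pad : ∀ n i u v → length u ≡ n → length v ≡ n →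
  P (n ℕ.+ i) (pad u i) (pad v i) ≈ cε (i ℕ.* (ones u ℕ.+ ones v)) ⊗ P n u v
P-pad n zero    u v l l' rewrite ℕₚ.+-identityʳ n | Listₚ.++-identityʳ u | Listₚ.++-identityʳ v =
  S.sym (S.*-identityˡ _)
P-pad n (suc i) u v l l' rewrite ℕₚ.+-suc n i | pad-suc u i | pad-suc v i = begin
  P (suc n ℕ.+ i) (pad (u ++ false ∷ []) i) (pad (v ++ false ∷ []) i)
    ≈⟨ P-pad (suc n) i (u ++ false ∷ []) (v ++ false ∷ [])
         (trans (length-∷ʳ u false) (cong suc l)) (trans (length-∷ʳ v false) (cong suc l')) ⟩
  cε (i ℕ.* (ones (u ++ false ∷ []) ℕ.+ ones (v ++ false ∷ []))) ⊗ P (suc n) (u ++ false ∷ []) (v ++ false ∷ [])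
    ≈⟨ S.*-cong (λ k → cong (λ a → cε (i ℕ.* a) k) (cong₂ ℕ._+_ (ones-∷ʳ u) (ones-∷ʳ v))) (P-∷ʳ-00 n u v l l') ⟩
  cε (i ℕ.* m) ⊗ (cε m ⊗ P n u v)
    ≈⟨ S.*-assoc _ _ _ ⟨
  cε (i ℕ.* m) ⊗ cε m ⊗ P n u v
    ≈⟨ S.*-congʳ (S.trans (λ k → cong (λ a → cε a k) (ℕₚ.+-comm m (i ℕ.* m))) (cε-+ (i ℕ.* m) m)) ⟨
  cε (m ℕ.+ i ℕ.* m) ⊗ P n u v ∎
  where
  open ≈-Reasoning
  m = ones u ℕ.+ ones v

P-pad-10 : ∀ n i u v → length u ≡ n → length v ≡ n →
  P (suc n ℕ.+ i) (pad (u ++ true ∷ []) i) (pad (v ++ false ∷ []) i) ≈ zeroS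
P-pad-10 n i u v l l' = S.trans
  (P-pad (suc n) i (u ++ true ∷ []) (v ++ false ∷ [])
    (trans (length-∷ʳ u true) (cong suc l)) (trans (length-∷ʳ v false) (cong suc l')))
  (S.trans (S.*-congˡ (P-∷ʳ-10 n u v)) (S.zeroʳ _))

-- Letter sequences as paths between states

≡ᵇ-refl : ∀ n → (n ≡ᵇ n) ≡ true
≡ᵇ-refl zero    = refl
≡ᵇ-refl (suc n) = ≡ᵇ-refl n

<⇒≡ᵇ-false : ∀ {a n} → a < n → (a ≡ᵇ n) ≡ false
<⇒≡ᵇ-false {zero}  (s≤s _)   = refl
<⇒≡ᵇ-false {suc a} (s≤s a<n) = <⇒≡ᵇ-false a<n

<⇒<ᵇ-true : ∀ {a n} → a < n → (a <ᵇ n) ≡ true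
<⇒<ᵇ-true {zero}  (s≤s _)   = refl
<⇒<ᵇ-true {suc a} (s≤s a<n) = <⇒<ᵇ-true a<n

≤⇒<ᵇ-false : ∀ {a n} → n ≤ a → (a <ᵇ n) ≡ false
≤⇒<ᵇ-false {a}     z≤n       = refl
≤⇒<ᵇ-false {suc a} (s≤s n≤a) = ≤⇒<ᵇ-false n≤a

≡ᵇ-true⇒≡ : ∀ a n → (a ≡ᵇ n) ≡ true → a ≡ n
≡ᵇ-true⇒≡ zero    zero    e = refl
≡ᵇ-true⇒≡ (suc a) (suc n) e = cong suc (≡ᵇ-true⇒≡ a n e)

-- The head of h ∷ t stands for the value `length t`, so a value is located by the number of letters
-- after it.
freeAt : ℕ → Word → Bool
freeAt a []      = false
freeAt a (h ∷ t) = if a ≡ᵇ length t then not h else freeAt a t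

setAt : ℕ → Word → Word
setAt a []      = []
setAt a (h ∷ t) = if a ≡ᵇ length t then true ∷ t else h ∷ setAt a t

below : ℕ → Word → Word
below a []      = []
below a (h ∷ t) = if a ≡ᵇ length t then t else below a t

wtAt : ℕ → Word → Series
wtAt a u = if freeAt a u then wt (below a u) else zeroS

free⇒< : ∀ a u → freeAt a u ≡ true → a < length u
free⇒< a (h ∷ t) e with a ≡ᵇ length t in eq
... | true  = s≤s (ℕₚ.≤-reflexive (≡ᵇ-true⇒≡ a (length t) eq))
... | false = ℕₚ.m≤n⇒m≤1+n (free⇒< a t e)

length-setAt : ∀ a u → length (setAt a u) ≡ length u
length-setAt a []      = refl
length-setAt a (h ∷ t) with a ≡ᵇ length t
... | true  = refl
... | false = cong suc (length-setAt a t)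

sumLS : {A : Set} → List A → (A → Series) → Series
sumLS []       F = zeroS
sumLS (x ∷ xs) F = F x ⊕ sumLS xs F

sumLS-++ : ∀ {A : Set} (xs ys : List A) F → sumLS (xs ++ ys) F ≈ sumLS xs F ⊕ sumLS ys F
sumLS-++ []       ys F = S.sym (S.+-identityˡ _)
sumLS-++ (x ∷ xs) ys F = S.trans (S.+-congˡ (sumLS-++ xs ys F)) (S.sym (S.+-assoc (F x) _ _))

sumLS-map : ∀ {A B : Set} (g : A → B) xs F → sumLS (map g xs) F ≈ sumLS xs (F ∘ g)
sumLS-map g []       F = S.refl
sumLS-map g (x ∷ xs) F = S.+-congˡ (sumLS-map g xs F)

sumLS-concatMap : ∀ {A B : Set} (g : A → List B) xs F →
  sumLS (concatMap g xs) F ≈ sumLS xs (λ x → sumLS (g x) F)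
sumLS-concatMap g []       F = S.refl
sumLS-concatMap g (x ∷ xs) F = S.trans (sumLS-++ (g x) (concatMap g xs) F) (S.+-congˡ (sumLS-concatMap g xs F))

sumLS-⊗ : ∀ {A : Set} c (xs : List A) F → sumLS xs (λ x → c ⊗ F x) ≈ c ⊗ sumLS xs F
sumLS-⊗ c []       F = S.sym (S.zeroʳ c)
sumLS-⊗ c (x ∷ xs) F = S.trans (S.+-congˡ (sumLS-⊗ c xs F)) (S.sym (S.distribˡ c _ _))

sumLS-upTo : ∀ n F → sumLS (upTo (suc n)) F ≈ sumLS (upTo n) F ⊕ F n
sumLS-upTo n F = S.trans (λ k → cong (λ xs → sumLS xs F k) (sym (Listₚ.upTo-∷ʳ n)))
  (S.trans (sumLS-++ (upTo n) (n ∷ []) F) (S.+-congˡ (S.+-identityʳ (F n))))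

sumLS-upTo-cong : ∀ n {F G : ℕ → Series} → (∀ a → a < n → F a ≈ G a) → sumLS (upTo n) F ≈ sumLS (upTo n) G
sumLS-upTo-cong zero            e = S.refl
sumLS-upTo-cong (suc n) {F} {G} e = S.trans (sumLS-upTo n F) (S.trans
  (S.+-cong (sumLS-upTo-cong n (λ a a<n → e a (ℕₚ.m≤n⇒m≤1+n a<n))) (e n ℕₚ.≤-refl))
  (S.sym (sumLS-upTo n G)))

sumLS-words : ∀ n k F → sumLS (words n (suc k)) F ≈ sumLS (upTo n) (λ a → sumLS (words n k) (λ l → F (a ∷ l)))
sumLS-words n k F = S.trans (sumLS-concatMap (λ a → map (a ∷_) (words n k)) (upTo n) F)
  (sumLS-upTo-cong n (λ a _ → sumLS-map (a ∷_) (words n k) F))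

sumLS-words-cong : ∀ n k {F G : List ℕ → Series} →
  (∀ l → length l ≡ k → All (_< n) l → F l ≈ G l) → sumLS (words n k) F ≈ sumLS (words n k) G
sumLS-words-cong n zero            e = S.+-congʳ (e [] refl [])
sumLS-words-cong n (suc k) {F} {G} e = S.trans (sumLS-words n k F) (S.trans
  (sumLS-upTo-cong n λ a a<n → sumLS-words-cong n k λ l eq <n → e (a ∷ l) (cong suc eq) (a<n ∷ <n))
  (S.sym (sumLS-words n k G)))

steps-letters : ∀ u G → steps u G ≈ sumLS (upTo (length u)) (λ a → wtAt a u ⊗ G (setAt a u))
steps-letters []      G = S.refl
steps-letters (h ∷ t) G = S.sym (S.trans (sumLS-upTo (length t) term) (S.trans
  (S.+-cong (S.trans (sumLS-upTo-cong (length t) other) (S.sym (steps-letters t (G ∘ (h ∷_))))) S.refl)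
  (last h refl)))
  where
  term : ℕ → Series
  term a = wtAt a (h ∷ t) ⊗ G (setAt a (h ∷ t))
  other : ∀ a → a < length t → term a ≈ wtAt a t ⊗ G (h ∷ setAt a t)
  other a a<n rewrite <⇒≡ᵇ-false a<n = S.refl
  last : ∀ h' → h ≡ h' → steps t (G ∘ (h ∷_)) ⊕ term (length t) ≈ steps (h' ∷ t) G
  last true  refl rewrite ≡ᵇ-refl (length t) = S.trans (S.+-congˡ (S.zeroˡ _)) (S.+-identityʳ _)
  last false refl rewrite ≡ᵇ-refl (length t) = S.+-comm _ _

W : Word → List ℕ → Series
W u []      = 1S
W u (a ∷ l) = wtAt a u ⊗ W (setAt a u) l

zeros-setAt : ∀ a u → freeAt a u ≡ true → zeros u ≡ suc (zeros (setAt a u))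
zeros-setAt a (h ∷ t)     e with a ≡ᵇ length t
zeros-setAt a (false ∷ t) e | true  = refl
zeros-setAt a (true ∷ t)  e | false = zeros-setAt a t e
zeros-setAt a (false ∷ t) e | false = cong suc (zeros-setAt a t e)

P-full : ∀ u → zeros u ≡ 0 → P (length u) u (replicate (length u) true) ≈ 1S
P-full []         z = S.refl
P-full (true ∷ u) z = P-full u z

δ-full : ∀ u k → zeros u ≡ suc k → δ u (replicate (length u) true) ≈ zeroS
δ-full (true ∷ u)  k z = δ-full u k z
δ-full (false ∷ u) k z = S.refl

-- Splitting off the first letter matches `words` with `P-first`. Sequences that repeat a letter or
-- use an occupied value have weight 0, so the sum may run over all words.
sum-W : ∀ k u → zeros u ≡ k →
  sumLS (words (length u) k) (W u) ≈ P (length u) u (replicate (length u) true)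
sum-W zero    u z = S.trans (S.+-identityʳ 1S) (S.sym (P-full u z))
sum-W (suc k) u z = begin
  sumLS (words n (suc k)) (W u)
    ≈⟨ sumLS-words n k (W u) ⟩
  sumLS (upTo n) (λ a → sumLS (words n k) (λ l → wtAt a u ⊗ W (setAt a u) l))
    ≈⟨ sumLS-upTo-cong n (λ a _ → S.trans (sumLS-⊗ (wtAt a u) (words n k) (W (setAt a u))) (next a)) ⟩
  sumLS (upTo n) (λ a → wtAt a u ⊗ P n (setAt a u) (replicate n true))
    ≈⟨ steps-letters u (λ u' → P n u' (replicate n true)) ⟨
  steps u (λ u' → P n u' (replicate n true))
    ≈⟨ S.trans (S.+-congʳ (δ-full u k z)) (S.+-identityˡ _) ⟨
  δ u (replicate n true) ⊕ steps u (λ u' → P n u' (replicate n true))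
    ≈⟨ P-first n u (replicate n true) refl ⟨
  P n u (replicate n true) ∎
  where
  open ≈-Reasoning
  n = length u
  next : ∀ a → wtAt a u ⊗ sumLS (words n k) (W (setAt a u)) ≈ wtAt a u ⊗ P n (setAt a u) (replicate n true)
  next a with freeAt a u in free
  ... | false = S.trans (S.zeroˡ _) (S.sym (S.zeroˡ _))
  ... | true  = S.*-congˡ (subst
    (λ m → sumLS (words m k) (W (setAt a u)) ≈ P m (setAt a u) (replicate m true))
    (length-setAt a u)
    (sum-W k (setAt a u) (ℕₚ.suc-injective (trans (sym (zeros-setAt a u free)) z))))

-- Inversions and occurrences read off along a sequence

freeSeq : Word → List ℕ → Bool
freeSeq u []      = true
freeSeq u (a ∷ l) = freeAt a u ∧ freeSeq (setAt a u) l

invSeq : Word → List ℕ → ℕ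
invSeq u []      = 0
invSeq u (a ∷ l) = zeros (below a u) ℕ.+ invSeq (setAt a u) l

occSeq : Word → List ℕ → ℕ
occSeq u []      = 0
occSeq u (a ∷ l) = area (below a u) ℕ.+ occSeq (setAt a u) l

q^-+ : ∀ a b → q^ (a ℕ.+ b) ≈ q^ a ⊗ q^ b
q^-+ zero    b = S.sym (S.*-identityˡ (q^ b))
q^-+ (suc a) b = S.trans (S.*-congˡ (q^-+ a b)) (S.sym (S.*-assoc X (q^ a) (q^ b)))

W-eq : ∀ u l → W u l ≈ (if freeSeq u l then cε (invSeq u l) ⊗ q^ (occSeq u l) else zeroS)
W-eq u []      = S.sym (S.*-identityˡ 1S)
W-eq u (a ∷ l) with freeAt a u
... | false = S.zeroˡ _
... | true  with freeSeq (setAt a u) l | W-eq (setAt a u) l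
...   | false | e = S.trans (S.*-congˡ e) (S.zeroʳ _)
...   | true  | e = begin
  (cε z ⊗ q^ c) ⊗ W (setAt a u) l
    ≈⟨ S.*-congˡ e ⟩
  (cε z ⊗ q^ c) ⊗ (cε z' ⊗ q^ c')
    ≈⟨ solve 4 (λ a b c d → (a :* b) :* (c :* d) := (a :* c) :* (b :* d)) (λ _ → refl) (cε z) (q^ c) (cε z') (q^ c') ⟩
  (cε z ⊗ cε z') ⊗ (q^ c ⊗ q^ c')
    ≈⟨ S.*-cong (cε-+ z z') (q^-+ c c') ⟨
  cε (z ℕ.+ z') ⊗ q^ (c ℕ.+ c') ∎
  where
  open ≈-Reasoning
  open S-Solver
  z  = zeros (below a u)
  z' = invSeq (setAt a u) l
  c  = area (below a u)
  c' = occSeq (setAt a u) l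

sumOver : (ℕ → ℕ) → List ℕ → ℕ
sumOver φ []      = 0
sumOver φ (a ∷ l) = φ a ℕ.+ sumOver φ l

sumZeros : (ℕ → ℕ) → Word → ℕ
sumZeros φ []          = 0
sumZeros φ (true ∷ t)  = sumZeros φ t
sumZeros φ (false ∷ t) = φ (length t) ℕ.+ sumZeros φ t

sumOnes : (ℕ → ℕ) → Word → ℕ
sumOnes φ []          = 0
sumOnes φ (true ∷ t)  = φ (length t) ℕ.+ sumOnes φ t
sumOnes φ (false ∷ t) = sumOnes φ t

swap-+ : ∀ a b c → a ℕ.+ (b ℕ.+ c) ≡ b ℕ.+ (a ℕ.+ c)
swap-+ a b c = trans (sym (ℕₚ.+-assoc a b c)) (trans (cong (ℕ._+ c) (ℕₚ.+-comm a b)) (ℕₚ.+-assoc b a c))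

sumZeros-setAt : ∀ φ a u → freeAt a u ≡ true → sumZeros φ u ≡ φ a ℕ.+ sumZeros φ (setAt a u)
sumZeros-setAt φ a (h ∷ t)     e with a ≡ᵇ length t in eq
sumZeros-setAt φ a (false ∷ t) e | true  = cong (λ b → φ b ℕ.+ sumZeros φ t) (sym (≡ᵇ-true⇒≡ a (length t) eq))
sumZeros-setAt φ a (true ∷ t)  e | false = sumZeros-setAt φ a t e
sumZeros-setAt φ a (false ∷ t) e | false rewrite length-setAt a t =
  trans (cong (φ (length t) ℕ.+_) (sumZeros-setAt φ a t e)) (swap-+ (φ (length t)) (φ a) _)

sumOnes-setAt : ∀ φ a u → freeAt a u ≡ true → sumOnes φ (setAt a u) ≡ φ a ℕ.+ sumOnes φ u
sumOnes-setAt φ a (h ∷ t)     e with a ≡ᵇ length t in eq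
sumOnes-setAt φ a (false ∷ t) e | true  = cong (λ b → φ b ℕ.+ sumOnes φ t) (sym (≡ᵇ-true⇒≡ a (length t) eq))
sumOnes-setAt φ a (false ∷ t) e | false = sumOnes-setAt φ a t e
sumOnes-setAt φ a (true ∷ t)  e | false rewrite length-setAt a t =
  trans (cong (φ (length t) ℕ.+_) (sumOnes-setAt φ a t e)) (swap-+ (φ (length t)) (φ a) _)

sumZeros-none : ∀ u φ → zeros u ≡ 0 → sumZeros φ u ≡ 0
sumZeros-none []         φ z = refl
sumZeros-none (true ∷ u) φ z = sumZeros-none u φ z

-- No pigeonhole argument is needed: l exhausts the unused values because it has the right length.
sumOver-free : ∀ φ u l → freeSeq u l ≡ true → zeros u ≡ length l → sumOver φ l ≡ sumZeros φ u
sumOver-free φ u []      f z = sym (sumZeros-none u φ z)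
sumOver-free φ u (a ∷ l) f z with freeAt a u in free
... | true = trans
  (cong (φ a ℕ.+_) (sumOver-free φ (setAt a u) l f (ℕₚ.suc-injective (trans (sym (zeros-setAt a u free)) z))))
  (sym (sumZeros-setAt φ a u free))

sumZeros-cong : ∀ {φ ψ} u → (∀ c → c < length u → φ c ≡ ψ c) → sumZeros φ u ≡ sumZeros ψ u
sumZeros-cong []          e = refl
sumZeros-cong (true ∷ t)  e = sumZeros-cong t (λ c c<n → e c (ℕₚ.m≤n⇒m≤1+n c<n))
sumZeros-cong (false ∷ t) e = cong₂ ℕ._+_ (e (length t) ℕₚ.≤-refl) (sumZeros-cong t (λ c c<n → e c (ℕₚ.m≤n⇒m≤1+n c<n)))

sumOnes-cong : ∀ {φ ψ} u → (∀ c → c < length u → φ c ≡ ψ c) → sumOnes φ u ≡ sumOnes ψ u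
sumOnes-cong []          e = refl
sumOnes-cong (false ∷ t) e = sumOnes-cong t (λ c c<n → e c (ℕₚ.m≤n⇒m≤1+n c<n))
sumOnes-cong (true ∷ t)  e = cong₂ ℕ._+_ (e (length t) ℕₚ.≤-refl) (sumOnes-cong t (λ c c<n → e c (ℕₚ.m≤n⇒m≤1+n c<n)))

sumOnes-+ : ∀ φ ψ u → sumOnes (λ c → φ c ℕ.+ ψ c) u ≡ sumOnes φ u ℕ.+ sumOnes ψ u
sumOnes-+ φ ψ []          = refl
sumOnes-+ φ ψ (false ∷ t) = sumOnes-+ φ ψ t
sumOnes-+ φ ψ (true ∷ t)  = trans (cong (φ (length t) ℕ.+ ψ (length t) ℕ.+_) (sumOnes-+ φ ψ t))
  (trans (ℕₚ.+-assoc (φ (length t)) (ψ (length t)) _)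
  (trans (cong (φ (length t) ℕ.+_) (swap-+ (ψ (length t)) (sumOnes φ t) (sumOnes ψ t)))
  (sym (ℕₚ.+-assoc (φ (length t)) (sumOnes φ t) _))))

sumZeros-0 : ∀ u → sumZeros (λ _ → 0) u ≡ 0
sumZeros-0 []          = refl
sumZeros-0 (true ∷ t)  = sumZeros-0 t
sumZeros-0 (false ∷ t) = sumZeros-0 t

sumOnes-0 : ∀ u → sumOnes (λ _ → 0) u ≡ 0
sumOnes-0 []          = refl
sumOnes-0 (true ∷ t)  = sumOnes-0 t
sumOnes-0 (false ∷ t) = sumOnes-0 t

sumZeros-1 : ∀ u → sumZeros (λ _ → 1) u ≡ zeros u
sumZeros-1 []          = refl
sumZeros-1 (true ∷ t)  = sumZeros-1 t
sumZeros-1 (false ∷ t) = cong suc (sumZeros-1 t)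

sumOnes-1 : ∀ u → sumOnes (λ _ → 1) u ≡ ones u
sumOnes-1 []          = refl
sumOnes-1 (false ∷ t) = sumOnes-1 t
sumOnes-1 (true ∷ t)  = cong suc (sumOnes-1 t)

less : ℕ → ℕ → ℕ
less a c = if c <ᵇ a then 1 else 0

between : ℕ → ℕ → ℕ → ℕ
between a b c = if (a <ᵇ c) ∧ (c <ᵇ b) then 1 else 0

countLess≡ : ∀ a l → countLess a l ≡ sumOver (less a) l
countLess≡ a []      = refl
countLess≡ a (c ∷ l) = cong (less a c ℕ.+_) (countLess≡ a l)

countBetween≡ : ∀ a b l → countBetween a b l ≡ sumOver (between a b) l
countBetween≡ a b []      = refl
countBetween≡ a b (c ∷ l) = cong (between a b c ℕ.+_) (countBetween≡ a b l)

zeros-below : ∀ a u → freeAt a u ≡ true → sumZeros (less a) (setAt a u) ≡ zeros (below a u)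
zeros-below a (h ∷ t) e with a ≡ᵇ length t in eq
zeros-below a (false ∷ t) e | true rewrite ≡ᵇ-true⇒≡ a (length t) eq =
  trans (sumZeros-cong t (λ c c<n → cong (if_then 1 else 0) (<⇒<ᵇ-true c<n))) (sumZeros-1 t)
zeros-below a (true ∷ t)  e | false = zeros-below a t e
zeros-below a (false ∷ t) e | false
  rewrite length-setAt a t | ≤⇒<ᵇ-false (ℕₚ.<⇒≤ (free⇒< a t e)) = zeros-below a t e

between-≥ : ∀ a b c → b ≤ c → between a b c ≡ 0
between-≥ a b c b≤c rewrite ≤⇒<ᵇ-false b≤c = cong (if_then 1 else 0) (Boolₚ.∧-zeroʳ (a <ᵇ c))

between-≤ : ∀ a b c → c ≤ a → between a b c ≡ 0
between-≤ a b c c≤a rewrite ≤⇒<ᵇ-false c≤a = refl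

between-1 : ∀ a b c → a < c → c < b → between a b c ≡ 1
between-1 a b c a<c c<b rewrite <⇒<ᵇ-true a<c | <⇒<ᵇ-true c<b = refl

between-inverted : ∀ a b c → b ≤ a → between a b c ≡ 0
between-inverted a b c b≤a with ℕₚ.≤-total c a
... | inj₁ c≤a = between-≤ a b c c≤a
... | inj₂ a≤c = between-≥ a b c (ℕₚ.≤-trans b≤a a≤c)

area-pairs : ∀ t b → length t ≤ b → sumOnes (λ a → sumZeros (between a b) t) t ≡ area t
area-pairs []          b l = refl
area-pairs (true ∷ t)  b l = cong₂ ℕ._+_
  (trans (sumZeros-cong t (λ c c<n → between-≤ (length t) b c (ℕₚ.<⇒≤ c<n))) (sumZeros-0 t))
  (area-pairs t b (ℕₚ.<⇒≤ l))
area-pairs (false ∷ t) b l = trans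
  (sumOnes-+ (λ a → between a b (length t)) (λ a → sumZeros (between a b) t) t)
  (cong₂ ℕ._+_
    (trans (sumOnes-cong t (λ a a<n → between-1 a b (length t) a<n l)) (sumOnes-1 t))
    (area-pairs t b (ℕₚ.<⇒≤ l)))

area-below : ∀ b u → freeAt b u ≡ true →
  sumOnes (λ a → sumZeros (between a b) (setAt b u)) u ≡ area (below b u)
area-below b (h ∷ t) e with b ≡ᵇ length t in eq
area-below b (false ∷ t) e | true  =
  area-pairs t b (ℕₚ.≤-reflexive (sym (≡ᵇ-true⇒≡ b (length t) eq)))
area-below b (false ∷ t) e | false rewrite length-setAt b t = trans
  (sumOnes-+ (λ a → between a b (length t)) (λ a → sumZeros (between a b) (setAt b t)) t)
  (trans (cong (ℕ._+ sumOnes (λ a → sumZeros (between a b) (setAt b t)) t) (trans (sumOnes-cong t (λ a _ → between-≥ a b (length t) (ℕₚ.<⇒≤ (free⇒< b t e)))) (sumOnes-0 t)))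
         (area-below b t e))
area-below b (true ∷ t)  e | false = cong₂ ℕ._+_
  (trans (sumZeros-cong (setAt b t) (λ c _ → between-inverted (length t) b c (ℕₚ.<⇒≤ (free⇒< b t e))))
         (sumZeros-0 (setAt b t)))
  (area-below b t e)

invSeq≡ : ∀ u l → freeSeq u l ≡ true → zeros u ≡ length l → invSeq u l ≡ inversions l
invSeq≡ u []      f z = refl
invSeq≡ u (a ∷ l) f z with freeAt a u in free
... | true = cong₂ ℕ._+_
    (trans (sym (zeros-below a u free)) (sym (trans (countLess≡ a l) (sumOver-free (less a) (setAt a u) l f z'))))
    (invSeq≡ (setAt a u) l f z')
  where z' = ℕₚ.suc-injective (trans (sym (zeros-setAt a u free)) z)

-- For the induction the start u must be arbitrary. Its used values precede l and can play the 1 of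
-- an occurrence, which the additional sum accounts for; it vanishes for the empty state.
occSeq≡ : ∀ u l → freeSeq u l ≡ true → zeros u ≡ length l →
  occSeq u l ≡ sumOnes (λ a → pairs132 a l) u ℕ.+ occ132 l
occSeq≡ u []      f z = sym (trans (ℕₚ.+-identityʳ _) (sumOnes-0 u))
occSeq≡ u (b ∷ l) f z with freeAt b u in free
... | true = begin
  area (below b u) ℕ.+ occSeq (setAt b u) l
    ≡⟨ cong₂ ℕ._+_ (sym between-sum) (occSeq≡ (setAt b u) l f z') ⟩
  A ℕ.+ (sumOnes (λ a → pairs132 a l) (setAt b u) ℕ.+ occ132 l)
    ≡⟨ cong (λ x → A ℕ.+ (x ℕ.+ occ132 l)) (sumOnes-setAt (λ a → pairs132 a l) b u free) ⟩
  A ℕ.+ (pairs132 b l ℕ.+ B ℕ.+ occ132 l)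
    ≡⟨ cong (λ x → A ℕ.+ (x ℕ.+ occ132 l)) (ℕₚ.+-comm (pairs132 b l) B) ⟩
  A ℕ.+ (B ℕ.+ pairs132 b l ℕ.+ occ132 l)
    ≡⟨ cong (A ℕ.+_) (ℕₚ.+-assoc B (pairs132 b l) (occ132 l)) ⟩
  A ℕ.+ (B ℕ.+ (pairs132 b l ℕ.+ occ132 l))
    ≡⟨ ℕₚ.+-assoc A B _ ⟨
  A ℕ.+ B ℕ.+ (pairs132 b l ℕ.+ occ132 l)
    ≡⟨ cong (ℕ._+ (pairs132 b l ℕ.+ occ132 l)) (sumOnes-+ (λ a → countBetween a b l) (λ a → pairs132 a l) u) ⟨
  sumOnes (λ a → countBetween a b l ℕ.+ pairs132 a l) u ℕ.+ (pairs132 b l ℕ.+ occ132 l) ∎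
  where
  open ≡-Reasoning
  z' = ℕₚ.suc-injective (trans (sym (zeros-setAt b u free)) z)
  A = sumOnes (λ a → countBetween a b l) u
  B = sumOnes (λ a → pairs132 a l) u
  between-sum : A ≡ area (below b u)
  between-sum = trans
    (sumOnes-cong u (λ a _ → trans (countBetween≡ a b l) (sumOver-free (between a b) (setAt b u) l f z')))
    (area-below b u free)

allFree : Word → List ℕ → Bool
allFree u []      = true
allFree u (a ∷ l) = freeAt a u ∧ allFree u l

freeAt-setAt : ∀ a c u → freeAt c (setAt a u) ≡ not (a ≡ᵇ c) ∧ freeAt c u
freeAt-setAt a c []      = sym (Boolₚ.∧-zeroʳ _)
freeAt-setAt a c (h ∷ t) with a ≡ᵇ length t in eqa | c ≡ᵇ length t in eqc
... | true  | true  rewrite eqc | ≡ᵇ-true⇒≡ a _ eqa | ≡ᵇ-true⇒≡ c _ eqc | ≡ᵇ-refl (length t) = refl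
... | true  | false rewrite eqc with a ≡ᵇ c in eq
...   | false = refl
...   | true  with () ← trans (sym eqa) (trans (cong (_≡ᵇ length t) (≡ᵇ-true⇒≡ a c eq)) eqc)
freeAt-setAt a c (h ∷ t) | false | true rewrite length-setAt a t | eqc with a ≡ᵇ c in eq
...   | false = refl
...   | true  with () ← trans (sym eqa) (trans (cong (_≡ᵇ length t) (≡ᵇ-true⇒≡ a c eq)) eqc)
freeAt-setAt a c (h ∷ t) | false | false rewrite length-setAt a t | eqc = freeAt-setAt a c t

allFree-setAt : ∀ a u l → allFree (setAt a u) l ≡ not (elemᵇ a l) ∧ allFree u l
allFree-setAt a u []      = refl
allFree-setAt a u (c ∷ l) rewrite freeAt-setAt a c u | allFree-setAt a u l with a ≡ᵇ c
... | true  = refl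
... | false = ∧-swap (freeAt c u) (not (elemᵇ a l)) (allFree u l)
  where
  ∧-swap : ∀ x y z → x ∧ (y ∧ z) ≡ y ∧ (x ∧ z)
  ∧-swap true  y z = refl
  ∧-swap false y z = sym (Boolₚ.∧-zeroʳ y)

freeSeq≡ : ∀ u l → freeSeq u l ≡ distinct l ∧ allFree u l
freeSeq≡ u []      = refl
freeSeq≡ u (a ∷ l) rewrite freeSeq≡ (setAt a u) l | allFree-setAt a u l =
  rearrange (freeAt a u) (distinct l) (not (elemᵇ a l)) (allFree u l)
  where
  rearrange : ∀ x y z w → x ∧ (y ∧ (z ∧ w)) ≡ (z ∧ y) ∧ (x ∧ w)
  rearrange true  true  z w = cong (_∧ w) (sym (Boolₚ.∧-identityʳ z))
  rearrange true  false z w = sym (cong (_∧ w) (Boolₚ.∧-zeroʳ z))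
  rearrange false y     z w = sym (Boolₚ.∧-zeroʳ (z ∧ y))

empty : ℕ → Word
empty n = replicate n false

freeAt-empty : ∀ n a → a < n → freeAt a (empty n) ≡ true
freeAt-empty (suc n) a a<1+n rewrite Listₚ.length-replicate n {false} with a ≡ᵇ n in eq
... | true  = refl
... | false = freeAt-empty n a (ℕₚ.≤∧≢⇒< (ℕₚ.≤-pred a<1+n) λ { refl → contradiction (trans (sym (≡ᵇ-refl a)) eq) (λ ()) })

allFree-empty : ∀ n l → All (_< n) l → allFree (empty n) l ≡ true
allFree-empty n []      []          = refl
allFree-empty n (a ∷ l) (a<n ∷ all) = cong₂ _∧_ (freeAt-empty n a a<n) (allFree-empty n l all)

sumOnes-empty : ∀ n φ → sumOnes φ (empty n) ≡ 0
sumOnes-empty zero    φ = refl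
sumOnes-empty (suc n) φ = sumOnes-empty n φ

zeros-empty : ∀ n → zeros (empty n) ≡ n
zeros-empty zero    = refl
zeros-empty (suc n) = cong suc (zeros-empty n)

signℤ : ℕ → ℤ
signℤ k = if evenᵇ k then ℤ.+ 1 else ℤ.- (ℤ.+ 1)

ε≡signℤ : ∀ k → ε k ≡ signℤ k / 1
ε≡signℤ 0             = refl
ε≡signℤ 1             = refl
ε≡signℤ (suc (suc k)) = trans
  (ℚ-Solver.solve 1 (λ a → ℚ-Solver._:=_ (ℚ-Solver.:-_ (ℚ-Solver.:-_ a)) a) refl (ε k)) (ε≡signℤ k)

q^-at : ∀ a n → q^ a n ≡ (if a ≡ᵇ n then 1ℚ else 0ℚ)
q^-at zero    zero    = refl
q^-at zero    (suc n) = refl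
q^-at (suc a) zero    = X-⊗-zero (q^ a)
q^-at (suc a) (suc n) = trans (X-⊗-suc (q^ a) n) (q^-at a n)

/1-+ : ∀ a b → (a ℤ.+ b) / 1 ≡ a / 1 + b / 1
/1-+ a b = ℚₚ.toℚᵘ-injective (begin
  toℚᵘ ((a ℤ.+ b) / 1)              ≈⟨ ℚₚ.toℚᵘ-fromℚᵘ (mkℚᵘ (a ℤ.+ b) 0) ⟩
  mkℚᵘ (a ℤ.+ b) 0                  ≈⟨ *≡* (cong (ℤ._* ℤ.+ 1) (sym (cong₂ ℤ._+_ (ℤₚ.*-identityʳ a) (ℤₚ.*-identityʳ b)))) ⟩
  mkℚᵘ a 0 ℚᵘ.+ mkℚᵘ b 0            ≈⟨ ℚᵘₚ.+-cong (ℚₚ.toℚᵘ-fromℚᵘ (mkℚᵘ a 0)) (ℚₚ.toℚᵘ-fromℚᵘ (mkℚᵘ b 0)) ⟨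
  toℚᵘ (a / 1) ℚᵘ.+ toℚᵘ (b / 1)    ≈⟨ ℚₚ.toℚᵘ-homo-+ (a / 1) (b / 1) ⟨
  toℚᵘ (a / 1 + b / 1)              ∎)
  where open import Relation.Binary.Reasoning.Setoid ℚᵘₚ.≃-setoid

permTerm : List ℕ → ℕ → ℤ
permTerm l r = if isPerm l ∧ (occ132 l ≡ᵇ r) then sign l else ℤ.+ 0

sumℤ-at : ∀ r ls → sumℤ (map (λ l → permTerm l r) ls) / 1 ≡ sumLS ls (λ l r → permTerm l r / 1) r
sumℤ-at r []       = refl
sumℤ-at r (l ∷ ls) = trans (/1-+ (permTerm l r) _)
  (trans (cong (permTerm l r / 1 +_) (sumℤ-at r ls)) (sym (⊕-at _ _ r)))

permTerm≈W : ∀ n l → length l ≡ n → All (_< n) l → (λ r → permTerm l r / 1) ≈ W (empty n) l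
permTerm≈W n l len all r = sym (trans (W-eq (empty n) l r) (go (distinct l) refl))
  where
  free≡ : freeSeq (empty n) l ≡ distinct l
  free≡ = trans (freeSeq≡ (empty n) l) (trans (cong (distinct l ∧_) (allFree-empty n l all)) (Boolₚ.∧-identityʳ _))
  z : zeros (empty n) ≡ length l
  z = trans (zeros-empty n) (sym len)
  go : ∀ b → distinct l ≡ b →
    (if freeSeq (empty n) l then cε (invSeq (empty n) l) ⊗ q^ (occSeq (empty n) l) else zeroS) r ≡ permTerm l r / 1
  go false e rewrite free≡ | e = refl
  go true  e rewrite free≡ | e
    | invSeq≡ (empty n) l (trans free≡ e) z
    | occSeq≡ (empty n) l (trans free≡ e) z
    | sumOnes-empty n (λ a → pairs132 a l) =
    trans (constS-⊗ (ε (inversions l)) (q^ (occ132 l)) r)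
    (trans (cong₂ _*_ (ε≡signℤ (inversions l)) (q^-at (occ132 l) r)) (final (occ132 l ≡ᵇ r)))
    where
    final : ∀ b → sign l / 1 * (if b then 1ℚ else 0ℚ) ≡ (if b then sign l else ℤ.+ 0) / 1
    final true  = ℚₚ.*-identityʳ (sign l / 1)
    final false = ℚₚ.*-zeroʳ (sign l / 1)

M≡P : ∀ r n → M r n ≡ P n (empty n) (replicate n true) r
M≡P r n = trans (sumℤ-at r (words n n)) (trans
  (sumLS-words-cong n n (permTerm≈W n) r)
  (subst (λ m → sumLS (words m n) (W (empty n)) ≈ P m (empty n) (replicate m true))
    (Listₚ.length-replicate n {false}) (sum-W n (empty n) (zeros-empty n)) r))

-- Reduction of sums over words to sums over cores

module ℕ-Solver = Data.Nat.Solver.+-*-Solver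

sumTo-offset : ∀ {G h c} → G 0 ≡ c + h 0 → (∀ k → G (suc k) ≡ h (suc k)) → ∀ n → sumTo G n ≡ c + sumTo h n
sumTo-offset         e0 e zero    = e0
sumTo-offset {G} {h} {c} e0 e (suc n) =
  trans (cong₂ _+_ (sumTo-offset {G} {h} {c} e0 e n) (e n)) (ℚₚ.+-assoc c (sumTo h n) (h (suc n)))

sumTo-drop : ∀ h n j → (∀ k → k < n → h k ≡ 0ℚ) → sumTo h (n ℕ.+ j) ≡ sumTo (λ k → h (n ℕ.+ k)) j
sumTo-drop h zero    j z = refl
sumTo-drop h (suc n) j z = begin
  sumTo h (suc (n ℕ.+ j))                               ≡⟨ sumTo-head h (n ℕ.+ j) ⟩
  h 0 + sumTo (λ k → h (suc k)) (n ℕ.+ j)               ≡⟨ cong₂ _+_ (z 0 (s≤s z≤n)) (sumTo-drop (λ k → h (suc k)) n j (λ k k<n → z (suc k) (s≤s k<n))) ⟩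
  0ℚ + sumTo (λ k → h (suc (n ℕ.+ k))) j                ≡⟨ ℚₚ.+-identityˡ _ ⟩
  sumTo (λ k → h (suc (n ℕ.+ k))) j                     ∎
  where open ≡-Reasoning

sumTo-extend-≤ : ∀ h {m n} → m ≤ n → (∀ l → m < l → h l ≡ 0ℚ) → sumTo h m ≡ sumTo h n
sumTo-extend-≤ h {m} {zero}  z≤n   z = refl
sumTo-extend-≤ h {m} {suc n} m≤1+n z with ℕₚ.m≤n⇒m<n∨m≡n m≤1+n
... | inj₂ refl = refl
... | inj₁ (s≤s m≤n) = trans (sumTo-extend-≤ h m≤n z)
  (sym (trans (cong (sumTo h n +_) (z (suc n) (s≤s m≤n))) (ℚₚ.+-identityʳ _)))

sumTo-extend : ∀ h m n → (∀ l → m < l → h l ≡ 0ℚ) → (∀ l → n < l → h l ≡ 0ℚ) → sumTo h m ≡ sumTo h n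
sumTo-extend h m n zm zn with ℕₚ.≤-total m n
... | inj₁ m≤n = sumTo-extend-≤ h m≤n zm
... | inj₂ n≤m = sym (sumTo-extend-≤ h n≤m zn)

sumW : ℕ → (Word → ℚ) → ℚ
sumW zero    F = F []
sumW (suc n) F = sumW n (F ∘ (false ∷_)) + sumW n (F ∘ (true ∷_))

sumWS-at : ∀ n F r → sumWS n F r ≡ sumW n (λ t → F t r)
sumWS-at zero    F r = refl
sumWS-at (suc n) F r = trans (⊕-at _ _ r)
  (cong₂ _+_ (sumWS-at n (F ∘ (false ∷_)) r) (sumWS-at n (F ∘ (true ∷_)) r))

-- sumL sums over the words that are empty or use the smallest value, and sumC over those
-- which in addition do not use the largest value.  The latter are called cores: a word of
-- any other form is obtained by surrounding a core with unused values below and used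
-- values above it, which does not change its area.
sumL : ℕ → (Word → ℚ) → ℚ
sumL zero          F = F []
sumL (suc zero)    F = F (true ∷ [])
sumL (suc (suc k)) F = sumL (suc k) (F ∘ (false ∷_)) + sumL (suc k) (F ∘ (true ∷_))

sumC : ℕ → (Word → ℚ) → ℚ
sumC zero          F = F []
sumC (suc zero)    F = 0ℚ
sumC (suc (suc l)) F = sumL (suc l) (F ∘ (false ∷_))

fill : ℕ → Word → Word
fill q t = replicate q true ++ t

peel-zeros : ∀ m F → sumW m F ≡ sumTo (λ k → sumL k (λ t → F (pad t (m ∸ k)))) m
peel-zeros zero    F = refl
peel-zeros (suc m) F = begin
  sumW m (F ∘ (false ∷_)) + sumW m (F ∘ (true ∷_))
    ≡⟨ cong₂ _+_ (peel-zeros m (F ∘ (false ∷_))) (peel-zeros m (F ∘ (true ∷_))) ⟩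
  sumTo (G false) m + sumTo (G true) m
    ≡⟨ sumTo-+ (G false) (G true) m ⟨
  sumTo (λ k → G false k + G true k) m
    ≡⟨ sumTo-offset {λ k → G false k + G true k} {h} {h₀} refl (λ k → refl) m ⟩
  h₀ + sumTo h m
    ≡⟨ sumTo-head (λ k → sumL k (λ t → F (pad t (suc m ∸ k)))) m ⟨
  sumTo (λ k → sumL k (λ t → F (pad t (suc m ∸ k)))) (suc m) ∎
  where
  open ≡-Reasoning
  G : Bool → ℕ → ℚ
  G b k = sumL k (λ t → F (b ∷ pad t (m ∸ k)))
  h : ℕ → ℚ
  h k = sumL (suc k) (λ t → F (pad t (m ∸ k)))
  h₀ : ℚ
  h₀ = F (pad [] (suc m))

LowReduced : Word → Set
LowReduced []          = ⊤
LowReduced (b ∷ [])    = b ≡ true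
LowReduced (_ ∷ b ∷ t) = LowReduced (b ∷ t)

HighReduced : Word → Set
HighReduced []          = ⊤
HighReduced (false ∷ _) = ⊤
HighReduced (true ∷ _)  = ⊥

sumL-cong : ∀ k {F G} → (∀ t → length t ≡ k → LowReduced t → F t ≡ G t) → sumL k F ≡ sumL k G
sumL-cong zero          e = e [] refl tt
sumL-cong (suc zero)    e = e (true ∷ []) refl refl
sumL-cong (suc (suc k)) e = cong₂ _+_
  (sumL-cong (suc k) λ { (b ∷ t) l low → e (false ∷ b ∷ t) (cong suc l) low })
  (sumL-cong (suc k) λ { (b ∷ t) l low → e (true ∷ b ∷ t) (cong suc l) low })

peel-ones : ∀ k F → sumL k F ≡ sumTo (λ l → sumC l (λ t → F (fill (k ∸ l) t))) k
peel-ones zero          F = refl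
peel-ones (suc zero)    F = sym (ℚₚ.+-identityʳ _)
peel-ones (suc (suc k)) F = trans (ℚₚ.+-comm (sumL (suc k) (F ∘ (false ∷_))) _) (cong₂ _+_
  (trans (peel-ones (suc k) (F ∘ (true ∷_)))
         (sumTo-cong-≤ (suc k) λ l l≤ → cong (λ q → sumC l (λ t → F (fill q t))) (sym (ℕₚ.+-∸-assoc 1 l≤))))
  (cong (λ q → sumL (suc k) (λ t → F (fill q (false ∷ t)))) (sym (ℕₚ.n∸n≡0 k))))

-- The last field is the finiteness: area at most r forces length at most 2r.
record Core (l : ℕ) (t : Word) : Set where
  field
    low      : LowReduced t
    high     : HighReduced t
    len      : length t ≡ l
    len≤area : l ≤ area t ℕ.+ area t

low-ones : ∀ b t → LowReduced (b ∷ t) → 1 ≤ ones (b ∷ t)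
low-ones true  t       low = s≤s z≤n
low-ones false (b ∷ t) low = low-ones b t low

low-area : ∀ t → LowReduced t → length t ≤ ones t ℕ.+ area t
low-area []              low = z≤n
low-area (true ∷ [])     low = s≤s z≤n
low-area (true ∷ b ∷ t)  low = s≤s (low-area (b ∷ t) low)
low-area (false ∷ b ∷ t) low =
  ℕₚ.≤-trans (s≤s (low-area (b ∷ t) low)) (ℕₚ.+-monoˡ-≤ (ones (b ∷ t) ℕ.+ area (b ∷ t)) (low-ones b t low))

core-false : ∀ l t → length t ≡ suc l → LowReduced t → Core (suc (suc l)) (false ∷ t)
core-false l (b ∷ t) len low = record
  { low = low ; high = tt ; len = cong suc len
  ; len≤area = subst (λ n → suc n ≤ a ℕ.+ a) len (ℕₚ.+-mono-≤ {1} {a} {length (b ∷ t)} {a}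
      (ℕₚ.≤-trans (low-ones b t low) (ℕₚ.m≤m+n _ _)) (low-area (b ∷ t) low)) }
  where a = area (false ∷ b ∷ t)

core-[] : Core 0 []
core-[] = record { low = tt ; high = tt ; len = refl ; len≤area = z≤n }

sumC-cong : ∀ l {F G} → (∀ t → Core l t → F t ≡ G t) → sumC l F ≡ sumC l G
sumC-cong zero          e = e [] core-[]
sumC-cong (suc zero)    e = refl
sumC-cong (suc (suc l)) e = sumL-cong (suc l) (λ t len low → e (false ∷ t) (core-false l t len low))

sumL-0 : ∀ k → sumL k (λ _ → 0ℚ) ≡ 0ℚ
sumL-0 zero          = refl
sumL-0 (suc zero)    = refl
sumL-0 (suc (suc k)) = cong₂ _+_ (sumL-0 (suc k)) (sumL-0 (suc k))

sumC-zero : ∀ l {F} → (∀ t → Core l t → F t ≡ 0ℚ) → sumC l F ≡ 0ℚ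
sumC-zero l e = trans (sumC-cong l e) (zeros′ l)
  where
  zeros′ : ∀ l → sumC l (λ _ → 0ℚ) ≡ 0ℚ
  zeros′ zero          = refl
  zeros′ (suc zero)    = refl
  zeros′ (suc (suc l)) = sumL-0 (suc l)

sumTo-sumL : ∀ k (F : Word → ℕ → ℚ) j → sumTo (λ i → sumL k (λ t → F t i)) j ≡ sumL k (λ t → sumTo (F t) j)
sumTo-sumL zero          F j = refl
sumTo-sumL (suc zero)    F j = refl
sumTo-sumL (suc (suc k)) F j = trans (sumTo-+ _ _ j)
  (cong₂ _+_ (sumTo-sumL (suc k) (F ∘ (false ∷_)) j) (sumTo-sumL (suc k) (F ∘ (true ∷_)) j))

sumTo-sumC : ∀ l (F : Word → ℕ → ℚ) j → sumTo (λ i → sumC l (λ t → F t i)) j ≡ sumC l (λ t → sumTo (F t) j)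
sumTo-sumC zero          F j = refl
sumTo-sumC (suc zero)    F j = sumTo-zero j (λ _ _ → refl)
sumTo-sumC (suc (suc l)) F j = sumTo-sumL (suc l) (F ∘ (false ∷_)) j

ones-pad : ∀ t i → ones (pad t i) ≡ ones t
ones-pad []          zero    = refl
ones-pad []          (suc i) = ones-pad [] i
ones-pad (true ∷ t)  i       = cong suc (ones-pad t i)
ones-pad (false ∷ t) i       = ones-pad t i

zeros-pad : ∀ t i → zeros (pad t i) ≡ zeros t ℕ.+ i
zeros-pad []          zero    = refl
zeros-pad []          (suc i) = cong suc (zeros-pad [] i)
zeros-pad (true ∷ t)  i       = zeros-pad t i
zeros-pad (false ∷ t) i       = cong suc (zeros-pad t i)

area-pad : ∀ t i → area (pad t i) ≡ area t
area-pad []          zero    = refl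
area-pad []          (suc i) = cong₂ ℕ._+_ (ones-pad [] i) (area-pad [] i)
area-pad (true ∷ t)  i       = area-pad t i
area-pad (false ∷ t) i       = cong₂ ℕ._+_ (ones-pad t i) (area-pad t i)

zeros-fill : ∀ q t → zeros (fill q t) ≡ zeros t
zeros-fill zero    t = refl
zeros-fill (suc q) t = zeros-fill q t

area-fill : ∀ q t → area (fill q t) ≡ area t
area-fill zero    t = refl
area-fill (suc q) t = area-fill q t

length-pad : ∀ t i → length (pad t i) ≡ length t ℕ.+ i
length-pad t i = trans (Listₚ.length-++ t) (cong (length t ℕ.+_) (Listₚ.length-replicate i))

length-fill : ∀ q t → length (fill q t) ≡ q ℕ.+ length t
length-fill q t = trans (Listₚ.length-++ (replicate q true)) (cong (ℕ._+ length t) (Listₚ.length-replicate q))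

ones+zeros : ∀ t → ones t ℕ.+ zeros t ≡ length t
ones+zeros []          = refl
ones+zeros (true ∷ t)  = cong suc (ones+zeros t)
ones+zeros (false ∷ t) = trans (ℕₚ.+-suc (ones t) (zeros t)) (cong suc (ones+zeros t))

-- Splitting a path between cores at its largest value

-- The number of used values above c is determined by the length of w; if it would be
-- negative then the lengths do not match and P vanishes.
Q : Word → Word → ℕ → Series
Q w c j = P (length w ℕ.+ j) (pad w j) (fill (length w ℕ.+ j ∸ length c) c)

P-fill : ∀ q n u c → HighReduced c →
  P (q ℕ.+ n) (fill q u) (fill (q ℕ.+ n ∸ length c) c) ≈ P n u (fill (n ∸ length c) c)
P-fill zero    n u c high = S.refl
P-fill (suc q) n u c high with length c ℕ.≤? q ℕ.+ n
... | yes c≤ rewrite ℕₚ.+-∸-assoc 1 c≤ = P-fill q n u c high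
... | no  c≰ with ℕₚ.≰⇒> c≰
...   | c> rewrite ℕₚ.m≤n⇒m∸n≡0 c> = S.trans (head c high c>) (S.sym (P-lengthʳ n u _ mismatch))
  where
  n<c : n < length c
  n<c = ℕₚ.≤-trans (s≤s (ℕₚ.m≤n+m n q)) c>
  head : ∀ c → HighReduced c → q ℕ.+ n < length c → P (suc q ℕ.+ n) (fill (suc q) u) c ≈ zeroS
  head (false ∷ c) _ _ = S.refl
  mismatch : length (fill (n ∸ length c) c) ≢ n
  mismatch e = ℕₚ.<⇒≢ n<c (sym (trans (cong (ℕ._+ length c) (sym (ℕₚ.m≤n⇒m∸n≡0 (ℕₚ.<⇒≤ n<c))))
    (trans (sym (length-fill (n ∸ length c) c)) e)))

Q-true : ∀ w c j → HighReduced c → Q (true ∷ w) c j ≈ Q w c j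
Q-true w c j high = P-fill 1 (length w ℕ.+ j) (pad w j) c high

ε-parity : ∀ a b x y → a ℕ.+ (x ℕ.+ x) ≡ b ℕ.+ (y ℕ.+ y) → ε a ≡ ε b
ε-parity a b x y e = trans (sym (drop a x)) (trans (cong ε e) (drop b y))
  where
  drop : ∀ a x → ε (a ℕ.+ (x ℕ.+ x)) ≡ ε a
  drop a x = trans (ε-+ a (x ℕ.+ x)) (trans (cong (ε a *_) (trans (ε-+ x x) (ε-square x))) (ℚₚ.*-identityʳ (ε a)))

-- The first part has as many steps, modulo 2, as k + `zeros w` + `zeros t`, and each gains i
-- inversions; the split itself contributes `zeros t` + i. In this form k and i interact only
-- through i · k.
signExp : Word → Word → ℕ → ℕ → ℕ
signExp w t k i = i ℕ.* (k ℕ.+ (zeros w ℕ.+ zeros t ℕ.+ 1)) ℕ.+ zeros t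

sign-parity : ∀ w t T k i → ones T ℕ.+ zeros t ≡ length w ℕ.+ k →
  ε (i ℕ.* (ones w ℕ.+ ones T) ℕ.+ (zeros t ℕ.+ i)) ≡ ε (signExp w t k i)
sign-parity w t T k i e =
  ε-parity (i ℕ.* (ones w ℕ.+ ones T) ℕ.+ (zeros t ℕ.+ i)) (signExp w t k i) (i ℕ.* zeros t) (i ℕ.* ones w) (begin
    i ℕ.* (ones w ℕ.+ ones T) ℕ.+ (zeros t ℕ.+ i) ℕ.+ (i ℕ.* zeros t ℕ.+ i ℕ.* zeros t)
      ≡⟨ solve 4 (λ i a b z → i :* (a :+ b) :+ (z :+ i) :+ (i :* z :+ i :* z) := i :* ((b :+ z) :+ (a :+ z)) :+ (z :+ i)) refl
           i (ones w) (ones T) (zeros t) ⟩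
    i ℕ.* ((ones T ℕ.+ zeros t) ℕ.+ (ones w ℕ.+ zeros t)) ℕ.+ (zeros t ℕ.+ i)
      ≡⟨ cong (λ x → i ℕ.* (x ℕ.+ (ones w ℕ.+ zeros t)) ℕ.+ (zeros t ℕ.+ i))
           (trans e (cong (ℕ._+ k) (sym (ones+zeros w)))) ⟩
    i ℕ.* ((ones w ℕ.+ zeros w ℕ.+ k) ℕ.+ (ones w ℕ.+ zeros t)) ℕ.+ (zeros t ℕ.+ i)
      ≡⟨ solve 5 (λ i k y z a → i :* ((a :+ y :+ k) :+ (a :+ z)) :+ (z :+ i)
           := i :* (k :+ (y :+ z :+ con 1)) :+ z :+ (i :* a :+ i :* a)) refl i k (zeros w) (zeros t) (ones w) ⟩
    signExp w t k i ℕ.+ (i ℕ.* ones w ℕ.+ i ℕ.* ones w) ∎)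
  where
  open ≡-Reasoning
  open ℕ-Solver

term : Word → Word → Word → ℕ → ℕ → Series
term w c t k i = cε (signExp w t k i) ⊗ (Q w t k ⊗ (q^ (area t) ⊗ Q t c i))

low-last : ∀ b w → LowReduced (b ∷ w) → Σ Word λ w₀ → b ∷ w ≡ w₀ ++ true ∷ []
low-last b []      refl = [] , refl
low-last b (a ∷ w) low with low-last a w low
... | w₀ , e = b ∷ w₀ , cong (b ∷_) e

pad-+ : ∀ t i j → pad t (i ℕ.+ j) ≡ pad (pad t i) j
pad-+ t zero    j = cong (λ u → pad u j) (sym (Listₚ.++-identityʳ t))
pad-+ t (suc i) j = trans (pad-suc t (i ℕ.+ j)) (trans (pad-+ (t ++ false ∷ []) i j)
  (cong (λ u → pad u j) (sym (pad-suc t i))))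

P-low : ∀ w j t k → LowReduced w → length t ≡ k → k < length w →
  P (length w ℕ.+ j) (pad w j) (pad t (length w ℕ.+ j ∸ k)) ≈ zeroS
P-low (b ∷ w) j t .(length t) low refl k< with low-last b w low
... | w₀ , e = subst (λ u → length t < length u → P (length u ℕ.+ j) (pad u j) (pad t (length u ℕ.+ j ∸ length t)) ≈ zeroS)
    (sym e) vanish k<
  where
  vanish : length t < length (w₀ ++ true ∷ []) →
    P (length (w₀ ++ true ∷ []) ℕ.+ j) (pad (w₀ ++ true ∷ []) j) (pad t (length (w₀ ++ true ∷ []) ℕ.+ j ∸ length t)) ≈ zeroS
  vanish t< rewrite length-∷ʳ w₀ true = subst (λ v → P (suc (length w₀) ℕ.+ j) (pad (w₀ ++ true ∷ []) j) v ≈ zeroS) (sym pad-eq)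
    (P-pad-10 (length w₀) j w₀ (pad t i) refl (trans (length-pad t i) (ℕₚ.m+[n∸m]≡n t≤)))
    where
    i = length w₀ ∸ length t
    t≤ : length t ≤ length w₀
    t≤ = ℕₚ.≤-pred t<
    exponent : suc (length w₀) ℕ.+ j ∸ length t ≡ i ℕ.+ suc j
    exponent = trans (cong (_∸ length t) (sym (ℕₚ.+-suc (length w₀) j))) (ℕₚ.+-∸-comm (suc j) t≤)
    pad-eq : pad t (suc (length w₀) ℕ.+ j ∸ length t) ≡ pad (pad t i ++ false ∷ []) j
    pad-eq = trans (cong (pad t) exponent) (trans (pad-+ t i (suc j)) (pad-suc (pad t i) j))

split : Word → Word → ℕ → Word → Series
split w c j t = P m (pad w j) t ⊗ (wt t ⊗ P m t (fill (m ∸ length c) c))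
  where m = length w ℕ.+ j

-- `P-pad` removes the i untouched values from the first factor at the price of a sign, and `P-fill`
-- removes the used values on top from the second.
split-core : ∀ w c k i t → HighReduced c → length t ≤ length w ℕ.+ k →
  split w c (k ℕ.+ i) (pad (fill (length w ℕ.+ k ∸ length t) t) i) ≈ term w c t k i
split-core w c k i t high-c t≤ = begin
  split w c (k ℕ.+ i) (pad T i)
    ≈⟨ S.*-cong first (S.*-cong weight second) ⟩
  (cε a ⊗ Q w t k) ⊗ ((cε (zeros t ℕ.+ i) ⊗ q^ (area t)) ⊗ Q t c i)
    ≈⟨ solve 5 (λ a p z q r → (a :* p) :* ((z :* q) :* r) := (a :* z) :* (p :* (q :* r))) (λ _ → refl)
         (cε a) (Q w t k) (cε (zeros t ℕ.+ i)) (q^ (area t)) (Q t c i) ⟩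
  cε a ⊗ cε (zeros t ℕ.+ i) ⊗ (Q w t k ⊗ (q^ (area t) ⊗ Q t c i))
    ≈⟨ S.*-congʳ (cε-+ a (zeros t ℕ.+ i)) ⟨
  cε (a ℕ.+ (zeros t ℕ.+ i)) ⊗ (Q w t k ⊗ (q^ (area t) ⊗ Q t c i))
    ≈⟨ S.*-congʳ (λ n → cong (λ e → constS e n) (sign-parity w t T k i zeros-T)) ⟩
  term w c t k i ∎
  where
  open ≈-Reasoning
  open S-Solver
  n = length w ℕ.+ k
  q = n ∸ length t
  T = fill q t
  a = i ℕ.* (ones w ℕ.+ ones T)
  m-eq : length w ℕ.+ (k ℕ.+ i) ≡ n ℕ.+ i
  m-eq = sym (ℕₚ.+-assoc (length w) k i)
  length-T : length T ≡ n
  length-T = trans (length-fill q t) (ℕₚ.m∸n+n≡m t≤)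
  first : P (length w ℕ.+ (k ℕ.+ i)) (pad w (k ℕ.+ i)) (pad T i) ≈ cε a ⊗ Q w t k
  first = subst₂ (λ m u → P m u (pad T i) ≈ cε a ⊗ Q w t k) (sym m-eq) (sym (pad-+ w k i))
    (subst (λ b → P (n ℕ.+ i) (pad (pad w k) i) (pad T i) ≈ cε (i ℕ.* (b ℕ.+ ones T)) ⊗ Q w t k) (ones-pad w k)
      (P-pad n i (pad w k) T (length-pad w k) length-T))
  zeros-T : ones T ℕ.+ zeros t ≡ n
  zeros-T = trans (cong (ones T ℕ.+_) (sym (zeros-fill q t))) (trans (ones+zeros T) length-T)
  m-eq' : length w ℕ.+ (k ℕ.+ i) ≡ q ℕ.+ (length t ℕ.+ i)
  m-eq' = trans m-eq (trans (cong (ℕ._+ i) (sym (ℕₚ.m∸n+n≡m t≤))) (ℕₚ.+-assoc q (length t) i))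
  second : P (length w ℕ.+ (k ℕ.+ i)) (pad T i) (fill (length w ℕ.+ (k ℕ.+ i) ∸ length c) c) ≈ Q t c i
  second = subst₂ (λ m u → P m u (fill (m ∸ length c) c) ≈ Q t c i) (sym m-eq')
    (sym (Listₚ.++-assoc (replicate q true) t (replicate i false)))
    (P-fill q (length t ℕ.+ i) (pad t i) c high-c)
  weight : wt (pad T i) ≈ cε (zeros t ℕ.+ i) ⊗ q^ (area t)
  weight rewrite zeros-pad T i | zeros-fill q t | area-pad T i | area-fill q t = S.refl

term-short : ∀ w c t k i r → length w ℕ.+ k < length t → term w c t k i r ≡ 0ℚ
term-short w c t k i r k< = S.trans
  (S.*-congˡ (S.trans (S.*-congʳ (P-lengthʳ _ (pad w k) _ mismatch)) (S.zeroˡ _))) (S.zeroʳ _) r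
  where
  mismatch : length (fill (length w ℕ.+ k ∸ length t) t) ≢ length w ℕ.+ k
  mismatch e = ℕₚ.<⇒≢ k< (sym (trans (cong (ℕ._+ length t) (sym (ℕₚ.m≤n⇒m∸n≡0 (ℕₚ.<⇒≤ k<))))
    (trans (sym (length-fill (length w ℕ.+ k ∸ length t) t)) e)))

shift : ℕ → Series → Series
shift zero    B m       = B m
shift (suc a) B zero    = 0ℚ
shift (suc a) B (suc m) = shift a B m

q^-⊗ : ∀ a B → q^ a ⊗ B ≈ shift a B
q^-⊗ zero    B m = S.*-identityˡ B m
q^-⊗ (suc a) B zero = trans (S.*-assoc X (q^ a) B 0) (X-⊗-zero (q^ a ⊗ B))
q^-⊗ (suc a) B (suc m) = trans (S.*-assoc X (q^ a) B (suc m)) (trans (X-⊗-suc (q^ a ⊗ B) m) (q^-⊗ a B m))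

shift-< : ∀ a B m → m < a → shift a B m ≡ 0ℚ
shift-< (suc a) B zero    _         = refl
shift-< (suc a) B (suc m) (s≤s m<a) = shift-< a B m m<a

shift-≥ : ∀ a B m → a ≤ m → shift a B m ≡ B (m ∸ a)
shift-≥ zero    B m       _         = refl
shift-≥ (suc a) B (suc m) (s≤s a≤m) = shift-≥ a B m a≤m

term-at : ∀ w c t k i r → term w c t k i r ≡
  sumTo (λ r₁ → ε (signExp w t k i) * (Q w t k r₁ * shift (area t) (Q t c i) (r ∸ r₁))) r
term-at w c t k i r = begin
  term w c t k i r
    ≡⟨ constS-⊗ (ε e) (Q w t k ⊗ (q^ (area t) ⊗ Q t c i)) r ⟩
  ε e * (Q w t k ⊗ (q^ (area t) ⊗ Q t c i)) r
    ≡⟨ cong (ε e *_) (S.*-congˡ {Q w t k} (q^-⊗ (area t) (Q t c i)) r) ⟩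
  ε e * (Q w t k ⊗ shift (area t) (Q t c i)) r
    ≡⟨ cong (ε e *_) (⊗-at (Q w t k) (shift (area t) (Q t c i)) r) ⟩
  ε e * sumTo (λ r₁ → Q w t k r₁ * shift (area t) (Q t c i) (r ∸ r₁)) r
    ≡⟨ sumTo-*ˡ (ε e) _ r ⟨
  sumTo (λ r₁ → ε e * (Q w t k r₁ * shift (area t) (Q t c i) (r ∸ r₁))) r ∎
  where
  open ≡-Reasoning
  e = signExp w t k i

term-large : ∀ w c t k i r → r < area t → term w c t k i r ≡ 0ℚ
term-large w c t k i r r< = trans (term-at w c t k i r) (sumTo-zero r λ r₁ _ → begin
  ε e * (Q w t k r₁ * shift (area t) (Q t c i) (r ∸ r₁))
    ≡⟨ cong (λ x → ε e * (Q w t k r₁ * x)) (shift-< (area t) (Q t c i) (r ∸ r₁) (ℕₚ.≤-trans (s≤s (ℕₚ.m∸n≤m r r₁)) r<)) ⟩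
  ε e * (Q w t k r₁ * 0ℚ)
    ≡⟨ trans (cong (ε e *_) (ℚₚ.*-zeroʳ (Q w t k r₁))) (ℚₚ.*-zeroʳ (ε e)) ⟩
  0ℚ ∎)
  where
  open ≡-Reasoning
  e = signExp w t k i

Q-false : ∀ w c j r → LowReduced w → HighReduced c → length c ≤ length w ℕ.+ j →
  Q (false ∷ w) c j r ≡ sumTo (λ k → sumTo (λ l → sumC l (λ t → term w c t k (j ∸ k) r)) (r ℕ.+ r)) j
Q-false w c j r low high c≤ rewrite ℕₚ.+-∸-assoc 1 c≤ = begin
  sumWS m (split w c j) r
    ≡⟨ sumWS-at m (split w c j) r ⟩
  sumW m (λ t → split w c j t r)
    ≡⟨ peel-zeros m (λ t → split w c j t r) ⟩
  sumTo (λ k → sumL k (λ t → split w c j (pad t (m ∸ k)) r)) (n ℕ.+ j)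
    ≡⟨ sumTo-drop (λ k → sumL k (λ t → split w c j (pad t (m ∸ k)) r)) n j (λ k k<n → trans (sumL-cong k (λ t lt _ → vanish k t lt k<n)) (sumL-0 k)) ⟩
  sumTo (λ k → sumL (n ℕ.+ k) (λ t → split w c j (pad t (m ∸ (n ℕ.+ k))) r)) j
    -- Cores longer than n + k do not fit and cores longer than 2r have area above r; both
    -- contribute 0. So the bound on l can be made independent of k, which allows the sums to be
    -- exchanged later.
    ≡⟨ sumTo-cong-≤ j (λ k k≤j → trans (peel-ones (n ℕ.+ k) (λ t → split w c j (pad t (m ∸ (n ℕ.+ k))) r)) (trans
         (sumTo-cong-≤ (n ℕ.+ k) (λ l l≤ → sumC-cong l (λ t core → cores k k≤j l l≤ t core)))
         (sumTo-extend (λ l → sumC l (λ t → term w c t k (j ∸ k) r)) (n ℕ.+ k) (r ℕ.+ r) (short k) (large k)))) ⟩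
  sumTo (λ k → sumTo (λ l → sumC l (λ t → term w c t k (j ∸ k) r)) (r ℕ.+ r)) j ∎
  where
  open ≡-Reasoning
  n = length w
  m = n ℕ.+ j
  vanish : ∀ k t → length t ≡ k → k < n → split w c j (pad t (m ∸ k)) r ≡ 0ℚ
  vanish k t lt k<n = S.trans (S.*-congʳ (P-low w j t k low lt k<n)) (S.zeroˡ _) r
  cores : ∀ k → k ≤ j → ∀ l → l ≤ n ℕ.+ k → ∀ t → Core l t →
    split w c j (pad (fill (n ℕ.+ k ∸ l) t) (m ∸ (n ℕ.+ k))) r ≡ term w c t k (j ∸ k) r
  cores k k≤j l l≤ t core with Core.len core
  ... | refl = subst₂ (λ j' i → split w c j' (pad (fill (n ℕ.+ k ∸ l) t) i) r ≡ term w c t k (j ∸ k) r)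
    (ℕₚ.m+[n∸m]≡n k≤j) (sym (ℕₚ.[m+n]∸[m+o]≡n∸o n j k)) (split-core w c k (j ∸ k) t high l≤ r)
  short : ∀ k l → n ℕ.+ k < l → sumC l (λ t → term w c t k (j ∸ k) r) ≡ 0ℚ
  short k l l> = sumC-zero l λ t core →
    term-short w c t k (j ∸ k) r (subst (n ℕ.+ k <_) (sym (Core.len core)) l>)
  large : ∀ k l → r ℕ.+ r < l → sumC l (λ t → term w c t k (j ∸ k) r) ≡ 0ℚ
  large k l l> = sumC-zero l λ t core → term-large w c t k (j ∸ k) r
    (ℕₚ.≰⇒> λ a≤r → ℕₚ.<⇒≱ l> (ℕₚ.≤-trans (Core.len≤area core) (ℕₚ.+-mono-≤ a≤r a≤r)))

-- Twisted convolutions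

twPow : ℕ → Series → Series
twPow zero    g = g
twPow (suc κ) g = tw (twPow κ g)

evenPart oddPart : Series → Series
evenPart f = constS ½ ⊗ (f ⊕ tw f)
oddPart  f = constS ½ ⊗ (f ⊕ ⊖ tw f)

-- The sign is that of `signExp` with i = j - k, κ = `zeros w` + `zeros t` + 1 and z = `zeros t`.
tconv : ℕ → ℕ → Series → Series → Series
tconv κ z f g j = sumTo (λ k → ε ((j ∸ k) ℕ.* (k ℕ.+ κ) ℕ.+ z) * (f k * g (j ∸ k))) j

twPow-at : ∀ κ g i → twPow κ g i ≡ ε (i ℕ.* κ) * g i
twPow-at zero    g i = sym (trans (cong (λ n → ε n * g i) (ℕₚ.*-zeroʳ i)) (ℚₚ.*-identityˡ (g i)))
twPow-at (suc κ) g i = begin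
  ε i * twPow κ g i                ≡⟨ cong (ε i *_) (twPow-at κ g i) ⟩
  ε i * (ε (i ℕ.* κ) * g i)        ≡⟨ ℚₚ.*-assoc (ε i) (ε (i ℕ.* κ)) (g i) ⟨
  ε i * ε (i ℕ.* κ) * g i          ≡⟨ cong (_* g i) (trans (sym (ε-+ i (i ℕ.* κ))) (cong ε (sym (ℕₚ.*-suc i κ)))) ⟩
  ε (i ℕ.* suc κ) * g i            ∎
  where open ≡-Reasoning

ε-* : ∀ i k → ε (i ℕ.* k) ≡ ½ * (1ℚ + ε k) + ½ * (1ℚ + - ε k) * ε i
ε-* i zero    = trans (cong ε (ℕₚ.*-zeroʳ i)) (sym (trans (cong (1ℚ +_) (ℚₚ.*-zeroˡ (ε i))) refl))
ε-* i (suc k) = begin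
  ε (i ℕ.* suc k)
    ≡⟨ trans (cong ε (ℕₚ.*-suc i k)) (trans (ε-+ i (i ℕ.* k)) (cong (ε i *_) (ε-* i k))) ⟩
  ε i * (½ * (1ℚ + ε k) + ½ * (1ℚ + - ε k) * ε i)
    ≡⟨ solve 2 (λ a b → b :* (con ½ :* (con 1ℚ :+ a) :+ con ½ :* (con 1ℚ :+ :- a) :* b)
         := con ½ :* (con 1ℚ :+ :- a) :* (b :* b) :+ con ½ :* (con 1ℚ :+ :- (:- a)) :* b) refl (ε k) (ε i) ⟩
  ½ * (1ℚ + - ε k) * (ε i * ε i) + ½ * (1ℚ + - (- ε k)) * ε i
    ≡⟨ cong (λ x → x + ½ * (1ℚ + - (- ε k)) * ε i) (trans (cong (½ * (1ℚ + - ε k) *_) (ε-square i)) (ℚₚ.*-identityʳ (½ * (1ℚ + - ε k)))) ⟩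
  ½ * (1ℚ + ε (suc k)) + ½ * (1ℚ + - ε (suc k)) * ε i ∎
  where open ≡-Reasoning
        open ℚ-Solver

-- The sign (-1)^(ik) is trivial for even k and replaces g(x) by g(-x) for odd k, so f is split by
-- parity. The exponent iκ amounts to κ further substitutions x ↦ -x in g.
tconv-eq : ∀ κ z f g → tconv κ z f g ≈ cε z ⊗ (evenPart f ⊗ twPow κ g ⊕ oddPart f ⊗ tw (twPow κ g))
tconv-eq κ z f g j = sym (begin
  (cε z ⊗ (evenPart f ⊗ G ⊕ oddPart f ⊗ tw G)) j
    ≡⟨ trans (constS-⊗ (ε z) _ j) (cong (ε z *_) (trans (⊕-at _ _ j) (cong₂ _+_ (⊗-at _ _ j) (⊗-at _ _ j)))) ⟩
  ε z * ((evenPart f *S G) j + (oddPart f *S tw G) j)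
    ≡⟨ cong (ε z *_) (sumTo-+ _ _ j) ⟨
  ε z * sumTo (λ k → evenPart f k * G (j ∸ k) + oddPart f k * tw G (j ∸ k)) j
    ≡⟨ sumTo-*ˡ (ε z) _ j ⟨
  sumTo (λ k → ε z * (evenPart f k * G (j ∸ k) + oddPart f k * tw G (j ∸ k))) j
    ≡⟨ sumTo-cong j (λ k → pointwise k (j ∸ k)) ⟩
  tconv κ z f g j ∎)
  where
  open ≡-Reasoning
  G = twPow κ g
  even-at : ∀ k → evenPart f k ≡ ½ * (f k + ε k * f k)
  even-at k = trans (constS-⊗ ½ _ k) (cong (½ *_) (⊕-at _ _ k))
  odd-at : ∀ k → oddPart f k ≡ ½ * (f k + - (ε k * f k))
  odd-at k = trans (constS-⊗ ½ _ k) (cong (½ *_) (trans (⊕-at _ _ k) (cong (f k +_) (⊖-at _ k))))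
  pointwise : ∀ k i → ε z * (evenPart f k * G i + oddPart f k * tw G i) ≡ ε (i ℕ.* (k ℕ.+ κ) ℕ.+ z) * (f k * g i)
  pointwise k i = begin
    ε z * (evenPart f k * G i + oddPart f k * (ε i * G i))
      ≡⟨ cong₂ (λ x y → ε z * (x * G i + y * (ε i * G i))) (even-at k) (odd-at k) ⟩
    ε z * (½ * (f k + ε k * f k) * G i + ½ * (f k + - (ε k * f k)) * (ε i * G i))
      ≡⟨ cong (λ x → ε z * (½ * (f k + ε k * f k) * x + ½ * (f k + - (ε k * f k)) * (ε i * x))) (twPow-at κ g i) ⟩
    ε z * (½ * (f k + ε k * f k) * (ε (i ℕ.* κ) * g i) + ½ * (f k + - (ε k * f k)) * (ε i * (ε (i ℕ.* κ) * g i)))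
      ≡⟨ solve 6 (λ z f e i c g → z :* (con ½ :* (f :+ e :* f) :* (c :* g) :+ con ½ :* (f :+ :- (e :* f)) :* (i :* (c :* g)))
           := (con ½ :* (con 1ℚ :+ e) :+ con ½ :* (con 1ℚ :+ :- e) :* i) :* c :* z :* (f :* g)) refl
           (ε z) (f k) (ε k) (ε i) (ε (i ℕ.* κ)) (g i) ⟩
    (½ * (1ℚ + ε k) + ½ * (1ℚ + - ε k) * ε i) * ε (i ℕ.* κ) * ε z * (f k * g i)
      ≡⟨ cong (λ x → x * ε (i ℕ.* κ) * ε z * (f k * g i)) (ε-* i k) ⟨
    ε (i ℕ.* k) * ε (i ℕ.* κ) * ε z * (f k * g i)
      ≡⟨ cong (λ x → x * ε z * (f k * g i)) (trans (sym (ε-+ (i ℕ.* k) (i ℕ.* κ))) (cong ε (sym (ℕₚ.*-distribˡ-+ i k κ)))) ⟩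
    ε (i ℕ.* (k ℕ.+ κ)) * ε z * (f k * g i)
      ≡⟨ cong (_* (f k * g i)) (ε-+ (i ℕ.* (k ℕ.+ κ)) z) ⟨
    ε (i ℕ.* (k ℕ.+ κ) ℕ.+ z) * (f k * g i) ∎
    where open ℚ-Solver

tconv-10 : ∀ f g → tconv 1 0 f g ≈ evenPart f ⊗ tw g ⊕ oddPart f ⊗ g
tconv-10 f g = S.trans (tconv-eq 1 0 f g) (S.trans (S.*-identityˡ _) (S.+-congˡ (S.*-congˡ (tw-involutive g))))

tconv-zeroʳ : ∀ κ z f g → g ≈ zeroS → tconv κ z f g ≈ zeroS
tconv-zeroʳ κ z f g e j = sumTo-zero j λ k _ →
  trans (cong (λ x → ε ((j ∸ k) ℕ.* (k ℕ.+ κ) ℕ.+ z) * (f k * x)) (e (j ∸ k)))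
  (trans (cong (ε ((j ∸ k) ℕ.* (k ℕ.+ κ) ℕ.+ z) *_) (ℚₚ.*-zeroʳ (f k))) (ℚₚ.*-zeroʳ (ε ((j ∸ k) ℕ.* (k ℕ.+ κ) ℕ.+ z))))

coeffQ : ℕ → Word → Word → Series
coeffQ r w c j = Q w c j r

-- Of the r occurrences, r₁ fall into the part before the split, `area t` to the split itself, and
-- the others into the part after it.
coreTerm : Word → Word → ℕ → Word → ℕ → Series
coreTerm w c r t r₁ =
  tconv (zeros w ℕ.+ zeros t ℕ.+ 1) (zeros t) (coeffQ r₁ w t) (λ i → shift (area t) (Q t c i) (r ∸ r₁))

coreSum : Word → Word → ℕ → ℕ → Series
coreSum w c r l j = sumC l (λ t → sumTo (λ r₁ → coreTerm w c r t r₁ j) r)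

Q-false-cores : ∀ w c j r → LowReduced w → HighReduced c → length c ≤ length w ℕ.+ j →
  Q (false ∷ w) c j r ≡ sumTo (λ l → coreSum w c r l j) (r ℕ.+ r)
Q-false-cores w c j r low high c≤ = begin
  Q (false ∷ w) c j r
    ≡⟨ Q-false w c j r low high c≤ ⟩
  sumTo (λ k → sumTo (λ l → sumC l (λ t → term w c t k (j ∸ k) r)) (r ℕ.+ r)) j
    ≡⟨ sumTo-swap (λ k l → sumC l (λ t → term w c t k (j ∸ k) r)) j (r ℕ.+ r) ⟩
  sumTo (λ l → sumTo (λ k → sumC l (λ t → term w c t k (j ∸ k) r)) j) (r ℕ.+ r)
    ≡⟨ sumTo-cong (r ℕ.+ r) (λ l → trans (sumTo-sumC l (λ t k → term w c t k (j ∸ k) r) j)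
         (sumC-cong l λ t _ → trans (sumTo-cong j (λ k → term-at w c t k (j ∸ k) r)) (sumTo-swap _ j r))) ⟩
  sumTo (λ l → coreSum w c r l j) (r ℕ.+ r) ∎
  where open ≡-Reasoning

afterFirst beforeLast : (ℕ → ℚ) → ℕ → ℚ
afterFirst h zero    = 0ℚ
afterFirst h (suc n) = sumTo (h ∘ suc) n
beforeLast h zero    = 0ℚ
beforeLast h (suc n) = sumTo h n

sumTo-first : ∀ h n → sumTo h n ≡ h 0 + afterFirst h n
sumTo-first h zero    = sym (ℚₚ.+-identityʳ (h 0))
sumTo-first h (suc n) = sumTo-head h n

sumTo-last : ∀ h n → sumTo h n ≡ beforeLast h n + h n
sumTo-last h zero    = sym (ℚₚ.+-identityˡ (h 0))
sumTo-last h (suc n) = refl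

-- Induction on the number of occurrences

module Main (s : Series) (s0 : s 0 ≡ 1ℚ) (s² : s ⊗ s ≈ oneMinus4x²) where

  open Sqrt s s0 s²

  good-afterFirst : ∀ (h : ℕ → Series) n → (∀ i → suc i ≤ n → Good (h (suc i))) →
    Good (λ j → afterFirst (λ i → h i j) n)
  good-afterFirst h zero    g = good-zero
  good-afterFirst h (suc n) g = good-sumTo (h ∘ suc) n (λ i i≤n → g i (s≤s i≤n))

  good-beforeLast : ∀ (h : ℕ → Series) n → (∀ i → i < n → Good (h i)) →
    Good (λ j → beforeLast (λ i → h i j) n)
  good-beforeLast h zero    g = good-zero
  good-beforeLast h (suc n) g = good-sumTo h n (λ i i≤n → g i (s≤s i≤n))

  good-sumL : ∀ k (F : Word → Series) → (∀ t → length t ≡ k → LowReduced t → Good (F t)) →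
    Good (λ j → sumL k (λ t → F t j))
  good-sumL zero          F g = g [] refl tt
  good-sumL (suc zero)    F g = g (true ∷ []) refl refl
  good-sumL (suc (suc k)) F g = good-resp (⊕-at _ _) (good-+
    (good-sumL (suc k) (F ∘ (false ∷_)) λ { (b ∷ t) l low → g (false ∷ b ∷ t) (cong suc l) low })
    (good-sumL (suc k) (F ∘ (true ∷_)) λ { (b ∷ t) l low → g (true ∷ b ∷ t) (cong suc l) low }))

  good-sumC : ∀ l (F : Word → Series) → (∀ t → Core l t → Good (F t)) → Good (λ j → sumC l (λ t → F t j))
  good-sumC zero          F g = g [] core-[]
  good-sumC (suc zero)    F g = good-zero
  good-sumC (suc (suc l)) F g =
    good-sumL (suc l) (F ∘ (false ∷_)) (λ t len low → g (false ∷ t) (core-false l t len low))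

  good-tail : ∀ {f} → Good (tailS f) → Good f
  good-tail {f} g = good-resp (λ n → sym (decomposed n)) (good-+ (good-const (f 0)) (good-* good-X g))
    where
    decomposed : f ≈ constS (f 0) ⊕ X ⊗ tailS f
    decomposed zero    = sym (trans (⊕-at _ _ 0) (trans (cong (f 0 +_) (X-⊗-zero (tailS f))) (ℚₚ.+-identityʳ (f 0))))
    decomposed (suc n) = sym (trans (⊕-at _ _ (suc n)) (trans (ℚₚ.+-identityˡ _) (X-⊗-suc (tailS f) n)))

  good-finite : ∀ N {f} → (∀ j → N ≤ j → f j ≡ 0ℚ) → Good f
  good-finite zero    z = good-resp (λ n → sym (z n z≤n)) good-zero
  good-finite (suc N) z = good-tail (good-finite N (λ j N≤j → z (suc j) (s≤s N≤j)))

  good-eventually : ∀ N {f g} → (∀ j → N ≤ j → f j ≡ g j) → Good g → Good f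
  good-eventually N {f} {g} e gg =
    good-resp (solve 2 (λ f g → f :- g :+ g := f) (λ _ → refl) f g) (good-+ (good-finite N difference) gg)
    where
    open S-Solver
    difference : ∀ j → N ≤ j → (f ⊕ ⊖ g) j ≡ 0ℚ
    difference j N≤j = trans (⊕-at f (⊖ g) j) (trans (cong₂ _+_ (e j N≤j) (⊖-at g j)) (ℚₚ.+-inverseʳ (g j)))

  good-evenPart : ∀ {f} → Good f → Good (evenPart f)
  good-evenPart g = good-* (good-const ½) (good-+ g (good-tw even g))

  good-oddPart : ∀ {f} → Good f → Good (oddPart f)
  good-oddPart g = good-* (good-const ½) (good-+ g (good-neg (good-tw even g)))

  good-twPow : ∀ κ {g} → Good g → Good (twPow κ g)
  good-twPow zero    gg = gg
  good-twPow (suc κ) gg = good-tw even (good-twPow κ gg)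

  good-tconv : ∀ κ z {f g} → Good f → Good g → Good (tconv κ z f g)
  good-tconv κ z {f} {g} gf gg = good-resp (S.sym (tconv-eq κ z f g))
    (good-* (good-const (ε z)) (good-+ (good-* (good-evenPart gf) (good-twPow κ gg))
                                       (good-* (good-oddPart gf) (good-tw even (good-twPow κ gg)))))

  -- All w and c are needed at once, because the cores t at which paths split need not be smaller
  -- than w or c; only r decreases.
  Claim : ℕ → Set
  Claim r = ∀ w c → LowReduced w → HighReduced c → Good (coeffQ r w c)

  module Step (r : ℕ) (IH : ∀ {r'} → r' < r → Claim r') where

    -- A nonempty core has positive area, so r₁ and r - r₁ - `area t` are both below r in every
    -- nonzero term.
    good-coreSum : ∀ w c l → LowReduced w → HighReduced c → Good (coreSum w c r (suc l))
    good-coreSum w c l low high = good-sumC (suc l) _ λ t core → good-sumTo (coreTerm w c r t) r λ r₁ r₁≤r → good t core r₁ r₁≤r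
      where
      good : ∀ t → Core (suc l) t → ∀ r₁ → r₁ ≤ r → Good (coreTerm w c r t r₁)
      good t core r₁ r₁≤r with area t ℕ.≤? r ∸ r₁
      ... | no  a≰ = good-resp (S.sym (tconv-zeroʳ _ _ (coeffQ r₁ w t) _ (λ i → shift-< (area t) (Q t c i) (r ∸ r₁) (ℕₚ.≰⇒> a≰)))) good-zero
      ... | yes a≤ = good-tconv _ _ (IH r₁<r w t low (Core.high core))
        (good-resp (λ i → sym (shift-≥ (area t) (Q t c i) (r ∸ r₁) a≤)) (IH r₂<r t c (Core.low core) high))
        where
        1≤a : 1 ≤ area t
        1≤a with area t | Core.len≤area core
        ... | suc a | _ = s≤s z≤n
        r₁<r : r₁ < r
        r₁<r = ℕₚ.m∸n≢0⇒n<m λ e → ℕₚ.<⇒≱ (ℕₚ.≤-trans 1≤a a≤) (ℕₚ.≤-reflexive e)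
        r₂<r : r ∸ r₁ ∸ area t < r
        r₂<r = ℕₚ.<-≤-trans (ℕₚ.∸-monoʳ-< 1≤a a≤) (ℕₚ.m∸n≤m r r₁)

    rest : Word → Word → Series
    rest w c j = afterFirst (λ l → coreSum w c r l j) (r ℕ.+ r)

    good-rest : ∀ w c → LowReduced w → HighReduced c → Good (rest w c)
    good-rest w c low high = good-afterFirst (coreSum w c r) (r ℕ.+ r) (λ l _ → good-coreSum w c l low high)

    Q-false-first : ∀ w c j → LowReduced w → HighReduced c → length c ≤ length w ℕ.+ j →
      coeffQ r (false ∷ w) c j ≡ sumTo (λ r₁ → coreTerm w c r [] r₁ j) r + rest w c j
    Q-false-first w c j low high c≤ =
      trans (Q-false-cores w c j r low high c≤) (sumTo-first (λ l → coreSum w c r l j) (r ℕ.+ r))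

    good-false : ∀ w c → LowReduced w → HighReduced c →
      (∀ r₁ → r₁ ≤ r → Good (coreTerm w c r [] r₁)) → Good (coeffQ r (false ∷ w) c)
    good-false w c low high g = good-eventually (length c)
      (λ j c≤ → trans (Q-false-first w c j low high (ℕₚ.≤-trans c≤ (ℕₚ.m≤n+m j (length w)))) (sym (⊕-at _ _ j)))
      (good-+ (good-sumTo (coreTerm w c r []) r g) (good-rest w c low high))

  -- Take K to be the defect Y - X · E. Its coefficient at j + 1 is `G j` once j ≥ N, so K is
  -- rational whatever the finitely many earlier coefficients are.
  good-linear : ∀ {Y α β G} N → Good α → Good β → Good G →
    (∀ j → N ≤ j → Y (suc j) ≡ (α ⊗ Y ⊕ β ⊗ tw Y) j + G j) → Good Y
  good-linear {Y} {α} {β} {G} N gα gβ gG e = good-solve even gK gα gβ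
    (solve 2 (λ y z → y := (y :- z) :+ z) (λ _ → refl) Y (X ⊗ E))
    where
    E K : Series
    E = α ⊗ Y ⊕ β ⊗ tw Y
    K = Y ⊕ ⊖ (X ⊗ E)
    open S-Solver
    gK : Good K
    gK = good-tail (good-eventually N (λ j N≤j → begin
      (Y ⊕ ⊖ (X ⊗ E)) (suc j)          ≡⟨ trans (⊕-at Y _ (suc j)) (cong (Y (suc j) +_) (trans (⊖-at _ (suc j)) (cong -_ (X-⊗-suc E j)))) ⟩
      Y (suc j) + - E j                ≡⟨ cong (_+ - E j) (e j N≤j) ⟩
      E j + G j + - E j                ≡⟨ ℚ-Solver.solve 2 (λ a b → ℚ-Solver._:=_ (ℚ-Solver._:+_ (ℚ-Solver._:+_ a b) (ℚ-Solver.:-_ a)) b) refl (E j) (G j) ⟩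
      G j                              ∎) gG)
      where open ≡-Reasoning

  -- This is `M 0`: paths without occurrences from the state with no value used to the one with all
  -- values used.
  a : Series
  a = coeffQ 0 [] []

  -- For r = 0 only the empty core remains, and both parts of the split are counted by `a` itself;
  -- its κ is 1 and z is 0.
  good-a : Good a
  good-a = good-base (begin
    a
      ≈⟨ a-eq ⟩
    1S ⊕ X ⊗ tconv 1 0 a a
      ≈⟨ S.+-congˡ (S.*-congˡ (tconv-10 a a)) ⟩
    1S ⊕ X ⊗ (evenPart a ⊗ tw a ⊕ oddPart a ⊗ a)
      ≈⟨ solve 3 (λ x a b → con 1ℚ :+ x :* ((con ½ :* (a :+ b)) :* b :+ (con ½ :* (a :- b)) :* a)
           := con 1ℚ :+ x :* (con ½ :* (a :* a :+ b :* b))) (λ _ → refl) X a (tw a) ⟩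
    1S ⊕ X ⊗ (constS ½ ⊗ (a ⊗ a ⊕ tw a ⊗ tw a)) ∎)
    where
    open ≈-Reasoning
    open S-Solver
    open Step 0 (λ ())
    a-eq : a ≈ 1S ⊕ X ⊗ tconv 1 0 a a
    a-eq zero    = sym (trans (⊕-at _ _ 0) (cong (1ℚ +_) (X-⊗-zero (tconv 1 0 a a))))
    a-eq (suc j) = trans (Q-false-first [] [] j tt tt z≤n) (trans (ℚₚ.+-identityʳ _)
      (sym (trans (⊕-at _ _ (suc j)) (trans (ℚₚ.+-identityˡ _) (X-⊗-suc (tconv 1 0 a a) j)))))

  module Induct (r : ℕ) (IH : ∀ {r'} → r' < r → Claim r') where

    open Step r IH

    -- Both extreme terms of the convolution in q contain the unknown series.
    good-Q-empty : Good (coeffQ r [] [])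
    good-Q-empty = by-cases r refl
      where
      by-cases : ∀ r' → r ≡ r' → Good (coeffQ r [] [])
      by-cases zero     refl = good-a
      by-cases (suc r') refl = good-linear 0
        (good-+ (good-oddPart good-a) (good-* (good-const ½) (good-+ good-a (good-tw even good-a))))
        (good-+ (good-evenPart good-a) (good-* (good-const ½) (good-+ (good-tw even good-a) (good-neg good-a))))
        (good-+ (good-beforeLast (λ i → h (suc i)) r' middle) (good-rest [] [] tt tt))
        (λ j _ → equation j)
        where
        h : ℕ → Series
        h = coreTerm [] [] r []
        Y : Series
        Y = coeffQ r [] []
        -- For 0 < r₁ < r the induction hypothesis covers both factors.
        middle : ∀ i → i < r' → Good (h (suc i))
        middle i i<r' = good-tconv 1 0 (IH (s≤s i<r') [] [] tt tt) (IH (s≤s (ℕₚ.m∸n≤m r' i)) [] [] tt tt)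
        last : h r ≈ tconv 1 0 Y a
        last j = cong (λ m → tconv 1 0 Y (λ i → Q [] [] i m) j) (ℕₚ.n∸n≡0 r')
        linear : tconv 1 0 a Y ⊕ tconv 1 0 Y a ≈
          (oddPart a ⊕ constS ½ ⊗ (a ⊕ tw a)) ⊗ Y ⊕ (evenPart a ⊕ constS ½ ⊗ (tw a ⊕ ⊖ a)) ⊗ tw Y
        linear = S.trans (S.+-cong (tconv-10 a Y) (tconv-10 Y a))
          (solve 4 (λ a b y z →
             ((con ½ :* (a :+ b)) :* z :+ (con ½ :* (a :- b)) :* y) :+ ((con ½ :* (y :+ z)) :* b :+ (con ½ :* (y :- z)) :* a)
             := (con ½ :* (a :- b) :+ con ½ :* (a :+ b)) :* y :+ (con ½ :* (a :+ b) :+ con ½ :* (b :- a)) :* z)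
             (λ _ → refl) a (tw a) Y (tw Y))
          where open S-Solver
        B : ℕ → ℚ
        B j = beforeLast (λ i → h (suc i) j) r'
        equation : ∀ j → Y (suc j) ≡
          ((oddPart a ⊕ constS ½ ⊗ (a ⊕ tw a)) ⊗ Y ⊕ (evenPart a ⊕ constS ½ ⊗ (tw a ⊕ ⊖ a)) ⊗ tw Y) j
            + (B ⊕ rest [] []) j
        equation j = begin
          Y (suc j)
            ≡⟨ Q-false-first [] [] j tt tt z≤n ⟩
          sumTo (λ i → h i j) (suc r') + rest [] [] j
            ≡⟨ cong (_+ rest [] [] j) (trans (sumTo-head (λ i → h i j) r') (cong (h 0 j +_) (sumTo-last (λ i → h (suc i) j) r'))) ⟩
          h 0 j + (B j + h r j) + rest [] [] j
            ≡⟨ cong (λ x → h 0 j + (B j + x) + rest [] [] j) (last j) ⟩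
          tconv 1 0 a Y j + (B j + tconv 1 0 Y a j) + rest [] [] j
            ≡⟨ solve 4 (λ x b y z → x :+ (b :+ y) :+ z := (x :+ y) :+ (b :+ z)) refl
                 (tconv 1 0 a Y j) (B j) (tconv 1 0 Y a j) (rest [] [] j) ⟩
          (tconv 1 0 a Y j + tconv 1 0 Y a j) + (B j + rest [] [] j)
            ≡⟨ cong₂ _+_ (trans (sym (⊕-at _ _ j)) (linear j)) (sym (⊕-at B (rest [] []) j)) ⟩
          ((oddPart a ⊕ constS ½ ⊗ (a ⊕ tw a)) ⊗ Y ⊕ (evenPart a ⊕ constS ½ ⊗ (tw a ⊕ ⊖ a)) ⊗ tw Y) j
            + (B ⊕ rest [] []) j ∎
          where open ≡-Reasoning
                open ℚ-Solver

    below-or-equal : ∀ w c → LowReduced w → HighReduced c → Good (coeffQ r w c) → ∀ r' → r' ≤ r → Good (coeffQ r' w c)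
    below-or-equal w c low high g r' r'≤r with ℕₚ.m≤n⇒m<n∨m≡n r'≤r
    ... | inj₁ r'<r = IH r'<r w c low high
    ... | inj₂ refl = g

    -- With target c the first factor runs from [] to [] and is known up to index r by
    -- `good-Q-empty`. The unknown therefore occurs only for r₁ = 0, multiplied by `a`.
    good-Q-[] : ∀ c → HighReduced c → Good (coeffQ r [] c)
    good-Q-[] c high = good-linear (length c) (good-oddPart good-a) (good-evenPart good-a)
      (good-+ (good-afterFirst h r others) (good-rest [] c tt high)) equation
      where
      h : ℕ → Series
      h = coreTerm [] c r []
      Y : Series
      Y = coeffQ r [] c
      others : ∀ i → suc i ≤ r → Good (h (suc i))
      others i i<r = good-tconv 1 0 (below-or-equal [] [] tt tt good-Q-empty (suc i) i<r)
        (IH (ℕₚ.∸-monoʳ-< {r} {suc i} {0} (s≤s z≤n) i<r) [] c tt high)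
      A : ℕ → ℚ
      A j = afterFirst (λ i → h i j) r
      equation : ∀ j → length c ≤ j → Y (suc j) ≡ (oddPart a ⊗ Y ⊕ evenPart a ⊗ tw Y) j + (A ⊕ rest [] c) j
      equation j c≤ = begin
        Y (suc j)
          ≡⟨ Q-false-first [] c j tt high c≤ ⟩
        sumTo (λ i → h i j) r + rest [] c j
          ≡⟨ cong (_+ rest [] c j) (sumTo-first (λ i → h i j) r) ⟩
        tconv 1 0 a Y j + A j + rest [] c j
          ≡⟨ ℚₚ.+-assoc (tconv 1 0 a Y j) (A j) (rest [] c j) ⟩
        tconv 1 0 a Y j + (A j + rest [] c j)
          ≡⟨ cong₂ _+_ (trans (tconv-10 a Y j) (S.+-comm (evenPart a ⊗ tw Y) (oddPart a ⊗ Y) j)) (sym (⊕-at A (rest [] c) j)) ⟩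
        (oddPart a ⊗ Y ⊕ evenPart a ⊗ tw Y) j + (A ⊕ rest [] c) j ∎
        where open ≡-Reasoning

    low-tail : ∀ b w → LowReduced (b ∷ w) → LowReduced w
    low-tail b []      low = tt
    low-tail b (_ ∷ w) low = low

    claim-step : Claim r
    claim-step []          c low high = good-Q-[] c high
    claim-step (true ∷ w)  c low high =
      good-resp (λ j → sym (Q-true w c j high r)) (claim-step w c (low-tail true w low) high)
    claim-step (false ∷ w) c low high = good-false w c low' high λ r₁ r₁≤r → good-tconv _ 0
      (below-or-equal w [] low' tt (claim-step w [] low' tt) r₁ r₁≤r)
      (below-or-equal [] c tt high (good-Q-[] c high) (r ∸ r₁) (ℕₚ.m∸n≤m r r₁))
      where low' = low-tail false w low

  claim : ∀ r → Claim r
  claim = <-rec Claim (λ r IH → Induct.claim-step r IH)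

  good-M : ∀ r → Good (M r)
  good-M r = good-resp (λ n → sym (trans (M≡P r n) (cong (λ v → P n (empty n) v r) (sym (Listₚ.++-identityʳ (replicate n true))))))
    (claim r [] [] tt tt)

-- Membership in ℚ(x, s)

good⇒InRatXS : ∀ s f → Poly.Good s f → InRatXS s f
good⇒InRatXS s f (d , (D , D≈d) , d0 , (N , N≈df)) =
  N , D , (λ D≡0 → 1≢0 (trans (sym d0) (trans (sym (D≈d 0)) (D≡0 0)))) ,
  λ n → trans (*S-cong {g = f} {g' = f} D≈d (λ _ → refl) n) (trans (sym (⊗-at d f n)) (sym (N≈df n)))
  where
  1≢0 : 1ℚ ≢ 0ℚ
  1≢0 ()

theorem9 : (r : ℕ) (s : Series) → s 0 ≡ 1ℚ → (∀ n → (s *S s) n ≡ oneMinus4x² n) →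
    InRatXS s (M r)
theorem9 r s s0 s² = good⇒InRatXS s (M r) (Main.good-M s s0 (λ n → trans (⊗-at s s n) (s² n)) r)
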